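{- Let $p$ be a prime, $N=p^e$ with $e\ge1$, and let $Q=p^m$ with $m\ge1$. Assume $\mathbb F_N\subseteq\mathbb F_Q$. Then $$\Lambda_N(U)=U(U-1)^{N-1}\in\mathbb F_p[U]$$ is not a permutation polynomial of $\mathbb F_Q$, and $$\#\Lambda_N(\mathbb F_Q)=Q-\frac QN=Q-\left\lceil\frac{Q-1}{N}\right\rceil.$$ Thus $\Lambda_N$ attains the Wan--Shiue--Chen upper bound over every finite field containing $\mathbb F_N$.
   Context: All finite fields of characteristic $p$ are regarded as subfields of a fixed algebraic closure $\overline{\mathbb F}_p$, so $\mathbb F_N\subseteq\mathbb F_Q$ means $e\mid m$. A polynomial is a permutation polynomial of $\mathbb F_Q$ if it induces a bijection of $\mathbb F_Q$. $\Lambda_N(\mathbb F_Q)$ denotes the image of $\Lambda_N$ on $\mathbb F_Q$. The Wan--Shiue--Chen upper bound is the known inequality $\#f(\mathbb F_Q)\le Q-\lceil (Q-1)/d\rceil$ for a polynomial $f\in\mathbb F_Q[U]$ of degree $d$ that is not a permutation polynomial of $\mathbb F_Q$. -}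

module Defs where

open import Level using (Level; _⊔_; 0ℓ)
open import Algebra.Bundles using (CommutativeRing)
open import Algebra.Apartness.Bundles using (HeytingField; HeytingCommutativeRing)
open import Data.Fin.Base using (Fin)
open import Data.Integer.Base as ℤ using (ℤ; +_; -[1+_])
import Data.Integer.Divisibility.Signed as ℤ∣
import Data.Integer.Properties as ℤ
import Data.Integer.Solver as ℤ
open import Data.List.Base using (List; []; _∷_; map; foldr)
open import Data.Nat.Base as ℕ using (ℕ; zero; suc; _∸_; NonZero)
import Data.Nat.Properties as ℕ
open import Data.Nat.Primality using (Prime; prime⇒nonZero)
open import Data.Product.Base using (∃-syntax; Σ-syntax; _×_; _,_; proj₁)
open import Data.Rational.Unnormalised.Base using (ceiling; _/_)
open import Function.Bundles using (Inverse)
open import Function.Definitions using (Bijective)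
open import Relation.Binary.Bundles using (Setoid)
import Relation.Binary.Construct.On as On
open import Relation.Binary.PropositionalEquality
  using (_≡_; refl; sym; subst; setoid)
open import Relation.Nullary using (¬_)

private variable
  c ℓ ℓ₁ ℓ₂ : Level

HasCardinality : Setoid c ℓ → ℕ → Set (c ⊔ ℓ)
HasCardinality S k = Inverse S (setoid (Fin k))

------------------------------------------------------------------------
-- Polynomials in one variable

-- Coefficient lists, constant term first.  Trailing zeros are allowed, so
-- the degree is a relation on coefficients, not the length of the list.
module Polynomial (R : CommutativeRing c ℓ) where
  open CommutativeRing R

  Poly : Set c
  Poly = List Carrier

  infixl 6 _+ₚ_ _-ₚ_
  infixl 7 _*ₚ_
  infixr 8 _^ₚ_

  _+ₚ_ : Poly → Poly → Poly
  []      +ₚ g       = g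
  (a ∷ f) +ₚ []      = a ∷ f
  (a ∷ f) +ₚ (b ∷ g) = (a + b) ∷ (f +ₚ g)

  _-ₚ_ : Poly → Poly → Poly
  f -ₚ g = f +ₚ map (-_) g

  _*ₚ_ : Poly → Poly → Poly
  []      *ₚ g = []
  (a ∷ f) *ₚ g = map (a *_) g +ₚ (0# ∷ (f *ₚ g))

  1ₚ : Poly
  1ₚ = 1# ∷ []

  U : Poly
  U = 0# ∷ 1# ∷ []

  _^ₚ_ : Poly → ℕ → Poly
  f ^ₚ zero  = 1ₚ
  f ^ₚ suc n = f *ₚ (f ^ₚ n)

  coeff : Poly → ℕ → Carrier
  coeff []      _       = 0#
  coeff (a ∷ f) zero    = a
  coeff (a ∷ f) (suc i) = coeff f i

  HasDegree : Poly → ℕ → Set ℓ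
  HasDegree f d = ¬ (coeff f d ≈ 0#) × (∀ i → d ℕ.< i → coeff f i ≈ 0#)

  eval : Poly → Carrier → Carrier
  eval f x = foldr (λ a r → a + x * r) 0# f

  IsPermutationPolynomial : Poly → Set (c ⊔ ℓ)
  IsPermutationPolynomial f = Bijective _≈_ _≈_ (eval f)

  -- The image { y | ∃ x, f(x) = y }; elements are compared by y alone.
  ValueSet : Poly → Setoid (c ⊔ ℓ) ℓ
  ValueSet f = On.setoid (CommutativeRing.setoid R) (proj₁ {B = λ y → ∃[ x ] eval f x ≈ y})

------------------------------------------------------------------------
-- The prime field 𝔽_p, as ℤ with congruence modulo p

module _ (p : ℕ) where

  infix 4 _≈[p]_
  _≈[p]_ : ℤ → ℤ → Set
  x ≈[p] y = + p ℤ∣.∣ (x ℤ.- y)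

  private
    open ℤ.+-*-Solver using (solve; _:=_; _:+_; _:*_; _:-_; :-_)

    ≡⇒≈ : ∀ {x y} → x ≡ y → x ≈[p] y
    ≡⇒≈ {x} refl = subst (+ p ℤ∣.∣_) (sym (ℤ.+-inverseʳ x)) (ℤ∣.divides ℤ.0ℤ refl)

    sym≈ : ∀ {x y} → x ≈[p] y → y ≈[p] x
    sym≈ {x} {y} h = subst (+ p ℤ∣.∣_)
      (solve 2 (λ x y → :- (x :- y) := y :- x) refl x y) (ℤ∣.∣m⇒∣-m h)

    trans≈ : ∀ {x y z} → x ≈[p] y → y ≈[p] z → x ≈[p] z
    trans≈ {x} {y} {z} h k = subst (+ p ℤ∣.∣_)
      (solve 3 (λ x y z → (x :- y) :+ (y :- z) := x :- z) refl x y z)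
      (ℤ∣.∣m∣n⇒∣m+n h k)

    +-cong≈ : ∀ {x y u v} → x ≈[p] y → u ≈[p] v → (x ℤ.+ u) ≈[p] (y ℤ.+ v)
    +-cong≈ {x} {y} {u} {v} h k = subst (+ p ℤ∣.∣_)
      (solve 4 (λ x y u v → (x :- y) :+ (u :- v) := (x :+ u) :- (y :+ v)) refl x y u v)
      (ℤ∣.∣m∣n⇒∣m+n h k)

    *-cong≈ : ∀ {x y u v} → x ≈[p] y → u ≈[p] v → (x ℤ.* u) ≈[p] (y ℤ.* v)
    *-cong≈ {x} {y} {u} {v} h k = subst (+ p ℤ∣.∣_)
      (solve 4 (λ x y u v → (x :- y) :* u :+ y :* (u :- v) := x :* u :- y :* v) refl x y u v)
      (ℤ∣.∣m∣n⇒∣m+n (ℤ∣.∣m⇒∣m*n u h) (ℤ∣.∣n⇒∣m*n y k))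

    -‿cong≈ : ∀ {x y} → x ≈[p] y → (ℤ.- x) ≈[p] (ℤ.- y)
    -‿cong≈ {x} {y} h = subst (+ p ℤ∣.∣_)
      (solve 2 (λ x y → :- (x :- y) := :- x :- :- y) refl x y) (ℤ∣.∣m⇒∣-m h)

  𝔽 : CommutativeRing 0ℓ 0ℓ
  𝔽 = record
    { Carrier = ℤ ; _≈_ = _≈[p]_
    ; _+_ = ℤ._+_ ; _*_ = ℤ._*_ ; -_ = ℤ.-_ ; 0# = ℤ.0ℤ ; 1# = ℤ.1ℤ
    ; isCommutativeRing = record
      { isRing = record
        { +-isAbelianGroup = record
          { isGroup = record
            { isMonoid = record
              { isSemigroup = record
                { isMagma = record
                  { isEquivalence = record
                    { refl  = λ {x} → ≡⇒≈ {x} refl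
                    ; sym   = λ {x} {y} → sym≈ {x} {y}
                    ; trans = λ {x} {y} {z} → trans≈ {x} {y} {z}
                    }
                  ; ∙-cong = λ {x} {y} {u} {v} → +-cong≈ {x} {y} {u} {v}
                  }
                ; assoc = λ x y z → ≡⇒≈ (ℤ.+-assoc x y z)
                }
              ; identity = (λ x → ≡⇒≈ (ℤ.+-identityˡ x)) , (λ x → ≡⇒≈ (ℤ.+-identityʳ x))
              }
            ; inverse = (λ x → ≡⇒≈ (ℤ.+-inverseˡ x)) , (λ x → ≡⇒≈ (ℤ.+-inverseʳ x))
            ; ⁻¹-cong = λ {x} {y} → -‿cong≈ {x} {y}
            }
          ; comm = λ x y → ≡⇒≈ (ℤ.+-comm x y)
          }
        ; *-cong = λ {x} {y} {u} {v} → *-cong≈ {x} {y} {u} {v}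
        ; *-assoc = λ x y z → ≡⇒≈ (ℤ.*-assoc x y z)
        ; *-identity = (λ x → ≡⇒≈ (ℤ.*-identityˡ x)) , (λ x → ≡⇒≈ (ℤ.*-identityʳ x))
        ; distrib = (λ x y z → ≡⇒≈ (ℤ.*-distribˡ-+ x y z)) , (λ x y z → ≡⇒≈ (ℤ.*-distribʳ-+ x y z))
        }
      ; *-comm = λ x y → ≡⇒≈ (ℤ.*-comm x y)
      }
    }

  Λ : ℕ → Polynomial.Poly 𝔽
  Λ N = U *ₚ ((U -ₚ 1ₚ) ^ₚ (N ∸ 1))
    where open Polynomial 𝔽

------------------------------------------------------------------------
-- Finite fields

-- For a finite carrier the apartness of a Heyting field carries no extra
-- information: x # y is invertibility of x - y, which is decidable there and,
-- by tightness, equivalent to ¬ (x ≈ y).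
toCommutativeRing : HeytingField c ℓ₁ ℓ₂ → CommutativeRing c ℓ₁
toCommutativeRing F = HeytingCommutativeRing.commutativeRing (HeytingField.heytingCommutativeRing F)

module _ (R : CommutativeRing c ℓ) where
  open CommutativeRing R using (Carrier; 1#; -_; semiring)
  open import Algebra.Properties.Semiring.Mult semiring using () renaming (_×_ to _·_)

  -- k ↦ k · 1.  When R is a field of characteristic p this respects
  -- congruence modulo p, and is the inclusion of the prime field 𝔽 p in R.
  ι : ℤ → Carrier
  ι (+ n)    = n · 1#
  ι -[1+ n ] = - (suc n · 1#)

  -- A polynomial over the prime field, regarded as a polynomial over R.
  baseChange : (p : ℕ) → Polynomial.Poly (𝔽 p) → Polynomial.Poly R
  baseChange p = map ι

------------------------------------------------------------------------
-- The Wan–Shiue–Chen bound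

-- Q - ⌈(Q-1)/d⌉
wanShiueChenBound : (Q d : ℕ) .{{_ : NonZero d}} → ℤ
wanShiueChenBound Q d = + Q ℤ.- ceiling ((+ Q ℤ.- + 1) / d)

-- The hypotheses of the bound (f has degree d and is not a permutation
-- polynomial of a field with Q elements) hold, with equality in its conclusion.
AttainsWanShiueChenBound : (R : CommutativeRing c ℓ) (Q : ℕ) → Polynomial.Poly R → Set (c ⊔ ℓ)
AttainsWanShiueChenBound R Q f =
  ¬ IsPermutationPolynomial f ×
  (∃[ d ] Σ[ d≢0 ∈ NonZero d ] HasDegree f d ×
    ∃[ k ] HasCardinality (ValueSet f) k × + k ≡ wanShiueChenBound Q d {{d≢0}})
  where open Polynomial R

primePower-nonZero : ∀ {p} → Prime p → ∀ e → NonZero (p ℕ.^ e)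
primePower-nonZero {p} p-prime e = ℕ.m^n≢0 p e {{prime⇒nonZero p-prime}}

{-# OPTIONS --safe #-}
module Submission where

-- Put N = n + 1 and Q = N^(k+1).  Under x = 1 + 1/s, the equation x (x - 1)^n = y
-- becomes the affine equation y s^N - s = 1.  If its linear part is injective in s there is a
-- solution by finiteness; otherwise y = v^n for some v ≠ 0, and w = v s turns the equation
-- into w^N - w = v, solvable exactly when Tr v = 0 (Tr the trace to 𝔽_N).  Rescaling v by
-- 𝔽_N^× when Tr v ≠ 0, the missed values are the y = v^n with Tr v = 1, and such v is unique.
-- There are Q/N elements of trace 1: the polynomial Tr - 1 has degree Q/N, while w ↦ w^N - w
-- has fibres of size at most N, so its image translated by one such element already has
-- at least Q/N elements.

open import Defs
open import Algebra.Apartness.Bundles using (HeytingField)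
open import Algebra.Bundles using (CommutativeMonoid; CommutativeRing)
import Algebra.Properties.CommutativeMonoid.Sum
import Algebra.Properties.CommutativeSemiring.Binomial
import Algebra.Properties.CommutativeSemiring.Exp
open import Algebra.Properties.Monoid.Sum using (sum-init-last)
import Algebra.Properties.Semiring.Exp
import Algebra.Solver.Ring
open import Algebra.Solver.Ring.AlmostCommutativeRing
  using (AlmostCommutativeRing; fromCommutativeRing; _-Raw-AlmostCommutative⟶_)
open import Data.Fin.Base using (Fin; zero; suc; fromℕ; inject₁)
open import Data.Fin.Permutation as Perm using (Permutation; permutation)
import Data.Fin.Properties as Fin
open import Data.Integer.Base as ℤ using (+_; -[1+_])
import Data.Integer.DivMod as ℤ
import Data.Integer.Properties as ℤ
open import Data.List.Base using (List; []; _∷_; map; length; filter; lookup; tabulate)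
import Data.List.Membership.Setoid
import Data.List.Membership.Setoid.Properties as Membership
import Data.List.Properties as List
open import Data.List.Relation.Unary.All as All using (All; []; _∷_)
import Data.List.Relation.Unary.All.Properties as All
open import Data.List.Relation.Unary.AllPairs using ([]; _∷_)
open import Data.List.Relation.Unary.Any as Any using (Any; here; there)
import Data.List.Relation.Unary.Any.Properties as Any
open import Data.List.Relation.Unary.Unique.Setoid using (Unique)
import Data.List.Relation.Unary.Unique.Setoid.Properties as Unique
open import Data.Maybe.Base as Maybe using (Maybe)
open import Data.Nat.Base as ℕ
  using (ℕ; zero; suc; _∸_; _/_; _!; _≤_; _<_; z≤n; s≤s; _≤′_; ≤′-reflexive; ≤′-step; NonZero)
open import Data.Nat.Combinatorics using (_C_; nCn≡1; nCk≡n!/k![n-k]!; k![n∸k]!∣n!)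
open import Data.Nat.Divisibility using (_∣_; divides; ∣⇒≤; m∣m*n; n∣m*n; ∣1⇒≡1)
open import Data.Nat.DivMod
  using ([m+kn]%n≡m%n; m<n⇒m%n≡m; +-distrib-/-∣ʳ; m<n⇒m/n≡0; m*n/n≡m; m/n*n≡m)
open import Data.Nat.Primality using (Prime; euclidsLemma; prime⇒nonTrivial)
import Data.Nat.Properties as ℕ
open import Data.Product.Base using (∃-syntax; _×_; _,_; proj₁; proj₂)
open import Data.Sum.Base using (inj₁; inj₂)
open import Data.Vec.Base using (Vec; []; _∷_; _∷ʳ_; zipWith; replicate)
open import Function.Base using (_∘_)
open import Function.Bundles using (Inverse)
open import Level using (Level)
open import Relation.Binary.Bundles using (Setoid)
open import Relation.Binary.Core using (REL)
import Relation.Binary.Definitions as Binary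
open import Relation.Binary.PropositionalEquality as ≡ using (_≡_; _≢_)
open import Relation.Nullary using (¬_; Dec; yes; no; contradiction; ¬?; _×-dec_)
open import Relation.Nullary.Decidable using (decidable-stable; map′)
open import Relation.Nullary.Decidable.Core using (dec⇒maybe)
open import Relation.Unary using (Pred; Decidable)

-- The ring homomorphism ℤ → R and reduction of Λ

-- The subfield 𝔽_N is never constructed. Membership is the equation a^N = a; that is all the
-- linearity of the trace uses, and for a ≠ 0 it says a^n = 1, so that rescaling v by such an a
-- leaves v^n unchanged. No dimension theory enters either: root counting bounds the fibres of Tr by
-- Q/N and those of w ↦ w^N - w by N. The product of these bounds is exactly Q, so neither has any
-- slack; this also yields that the kernel of Tr is the image of w ↦ w^N - w, an additive Hilbert 90
-- obtained by counting. The dichotomy on the linear part comes from y s^N - s = s (y s^n - 1): its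
-- kernel is nonzero exactly when y u^n = 1 for some u, and then v = 1/u. The substitution never
-- reaches x = 1, but that point only gives the value 0, which x = 0 attains as well.

module IntegerImage {c ℓ} (R : CommutativeRing c ℓ) where
  open CommutativeRing R
  open import Algebra.Properties.Ring ring
  open import Algebra.Properties.AbelianGroup +-abelianGroup using (⁻¹-∙-comm)
  open import Algebra.Properties.CommutativeSemigroup +-commutativeSemigroup using (interchange)
  open import Algebra.Properties.Semiring.Mult semiring
    using (×-homo-+; ×1-homo-*; ×-homo-1) renaming (_×_ to _·_)
  open import Relation.Binary.Reasoning.Setoid setoid

  ι-⊖ : ∀ m n → ι R (m ℤ.⊖ n) ≈ m · 1# - n · 1#
  ι-⊖ m       zero    = sym (trans (+-congˡ -0#≈0#) (+-identityʳ _))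
  ι-⊖ zero    (suc n) = sym (+-identityˡ _)
  ι-⊖ (suc m) (suc n) = begin
    ι R (suc m ℤ.⊖ suc n)                  ≡⟨ ≡.cong (ι R) (ℤ.[1+m]⊖[1+n]≡m⊖n m n) ⟩
    ι R (m ℤ.⊖ n)                          ≈⟨ ι-⊖ m n ⟩
    m · 1# - n · 1#                        ≈⟨ +-identityˡ _ ⟨
    0# + (m · 1# - n · 1#)                 ≈⟨ +-congʳ (-‿inverseʳ 1#) ⟨
    (1# - 1#) + (m · 1# - n · 1#)          ≈⟨ interchange _ _ _ _ ⟩
    (1# + m · 1#) + (- 1# + - (n · 1#))    ≈⟨ +-congˡ (⁻¹-∙-comm _ _) ⟩
    suc m · 1# - suc n · 1#                ∎

  ι-+ : ∀ i j → ι R (i ℤ.+ j) ≈ ι R i + ι R j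
  ι-+ (+ m)    (+ n)    = ×-homo-+ 1# m n
  ι-+ (+ m)    -[1+ n ] = ι-⊖ m (suc n)
  ι-+ -[1+ m ] (+ n)    = trans (ι-⊖ n (suc m)) (+-comm _ _)
  ι-+ -[1+ m ] -[1+ n ] = begin
    - (suc (suc (m ℕ.+ n)) · 1#)           ≡⟨ ≡.cong (λ k → - (suc k · 1#)) (ℕ.+-suc m n) ⟨
    - ((suc m ℕ.+ suc n) · 1#)             ≈⟨ -‿cong (×-homo-+ 1# (suc m) (suc n)) ⟩
    - (suc m · 1# + suc n · 1#)            ≈⟨ ⁻¹-∙-comm _ _ ⟨
    - (suc m · 1#) + - (suc n · 1#)        ∎

  ι-neg : ∀ i → ι R (ℤ.- i) ≈ - ι R i
  ι-neg (+ zero)    = sym -0#≈0#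
  ι-neg (+ (suc n)) = refl
  ι-neg -[1+ n ]    = sym (-‿involutive _)

  ι-*-ℕ : ∀ m j → ι R (+ m ℤ.* j) ≈ (m · 1#) * ι R j
  ι-*-ℕ m (+ n) = begin
    ι R (+ m ℤ.* + n)          ≡⟨ ≡.cong (ι R) (ℤ.pos-* m n) ⟨
    (m ℕ.* n) · 1#             ≈⟨ ×1-homo-* m n ⟩
    (m · 1#) * (n · 1#)        ∎
  ι-*-ℕ m -[1+ n ] = begin
    ι R (+ m ℤ.* -[1+ n ])         ≡⟨ ≡.cong (ι R) (ℤ.neg-distribʳ-* (+ m) (+ suc n)) ⟨
    ι R (ℤ.- (+ m ℤ.* + suc n))    ≈⟨ ι-neg (+ m ℤ.* + suc n) ⟩
    - ι R (+ m ℤ.* + suc n)        ≈⟨ -‿cong (ι-*-ℕ m (+ suc n)) ⟩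
    - ((m · 1#) * (suc n · 1#))    ≈⟨ -‿distribʳ-* _ _ ⟩
    (m · 1#) * - (suc n · 1#)      ∎

  ι-* : ∀ i j → ι R (i ℤ.* j) ≈ ι R i * ι R j
  ι-* (+ m)    j = ι-*-ℕ m j
  ι-* -[1+ m ] j = begin
    ι R (-[1+ m ] ℤ.* j)           ≡⟨ ≡.cong (ι R) (ℤ.neg-distribˡ-* (+ suc m) j) ⟨
    ι R (ℤ.- (+ suc m ℤ.* j))      ≈⟨ ι-neg (+ suc m ℤ.* j) ⟩
    - ι R (+ suc m ℤ.* j)          ≈⟨ -‿cong (ι-*-ℕ (suc m) j) ⟩
    - ((suc m · 1#) * ι R j)       ≈⟨ -‿distribˡ-* _ _ ⟩
    - (suc m · 1#) * ι R j         ∎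

  ι-1 : ι R (+ 1) ≈ 1#
  ι-1 = ×-homo-1 1#

  private
    AR = fromCommutativeRing R

    ι-morphism : AlmostCommutativeRing.rawRing (fromCommutativeRing ℤ.+-*-commutativeRing)
                   -Raw-AlmostCommutative⟶ AR
    ι-morphism = record
      { ⟦_⟧ = ι R ; +-homo = ι-+ ; *-homo = ι-* ; -‿homo = ι-neg
      ; 0-homo = refl ; 1-homo = ι-1 }

    ι-≟ : ∀ i j → Maybe (ι R i ≈ ι R j)
    ι-≟ i j = Maybe.map (λ i≡j → reflexive (≡.cong (ι R) i≡j)) (dec⇒maybe (i ℤ.≟ j))

  -- Coefficients are taken in ℤ, where equality is decidable although it need not be in `R`. The
  -- constant 1 would be read as `ι R (+ 1)`, that is `1# + 0#`, so the unit enters later identities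
  -- as a variable, usually named `o`.
  module Solver = Algebra.Solver.Ring _ AR ι-morphism ι-≟

module BaseChange {c ℓ} (R : CommutativeRing c ℓ) (p : ℕ) where
  open CommutativeRing R
  open IntegerImage R
  open import Algebra.Properties.Semiring.Exp semiring using (_^_; ^-congˡ)
  open import Relation.Binary.Reasoning.Setoid setoid
  open Polynomial (𝔽 p) hiding (eval)
  private
    module R = Polynomial R
    open Solver using (solve; _:=_; _:+_; _:*_; _:-_; :-_; con)

  evalℤ : Poly → Carrier → Carrier
  evalℤ f = R.eval (baseChange R p f)

  eval-+ : ∀ f g x → evalℤ (f +ₚ g) x ≈ evalℤ f x + evalℤ g x
  eval-+ []      g       x = sym (+-identityˡ _)
  eval-+ (a ∷ f) []      x = sym (+-identityʳ _)
  eval-+ (a ∷ f) (b ∷ g) x = begin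
    ι R (a ℤ.+ b) + x * evalℤ (f +ₚ g) x
      ≈⟨ +-cong (ι-+ a b) (*-congˡ (eval-+ f g x)) ⟩
    (ι R a + ι R b) + x * (evalℤ f x + evalℤ g x)
      ≈⟨ solve 5 (λ a b x u v → (a :+ b) :+ x :* (u :+ v) := (a :+ x :* u) :+ (b :+ x :* v))
           refl _ _ _ _ _ ⟩
    (ι R a + x * evalℤ f x) + (ι R b + x * evalℤ g x) ∎

  eval-scale : ∀ a f x → evalℤ (map (a ℤ.*_) f) x ≈ ι R a * evalℤ f x
  eval-scale a []      x = sym (zeroʳ _)
  eval-scale a (b ∷ f) x = begin
    ι R (a ℤ.* b) + x * evalℤ (map (a ℤ.*_) f) x
      ≈⟨ +-cong (ι-* a b) (*-congˡ (eval-scale a f x)) ⟩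
    ι R a * ι R b + x * (ι R a * evalℤ f x)
      ≈⟨ solve 4 (λ a b x u → a :* b :+ x :* (a :* u) := a :* (b :+ x :* u)) refl _ _ _ _ ⟩
    ι R a * (ι R b + x * evalℤ f x) ∎

  eval-* : ∀ f g x → evalℤ (f *ₚ g) x ≈ evalℤ f x * evalℤ g x
  eval-* []      g x = sym (zeroˡ _)
  eval-* (a ∷ f) g x = begin
    evalℤ (map (a ℤ.*_) g +ₚ (+ 0 ∷ (f *ₚ g))) x
      ≈⟨ eval-+ (map (a ℤ.*_) g) (+ 0 ∷ (f *ₚ g)) x ⟩
    evalℤ (map (a ℤ.*_) g) x + (0# + x * evalℤ (f *ₚ g) x)
      ≈⟨ +-cong (eval-scale a g x) (+-congˡ (*-congˡ (eval-* f g x))) ⟩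
    ι R a * evalℤ g x + (0# + x * (evalℤ f x * evalℤ g x))
      ≈⟨ solve 4 (λ a x u v → a :* v :+ (con (+ 0) :+ x :* (u :* v)) := (a :+ x :* u) :* v)
           refl _ _ _ _ ⟩
    (ι R a + x * evalℤ f x) * evalℤ g x ∎

  eval-^ : ∀ f n x → evalℤ (f ^ₚ n) x ≈ evalℤ f x ^ n
  eval-^ f zero    x = begin
    ι R (+ 1) + x * 0#   ≈⟨ +-cong ι-1 (zeroʳ x) ⟩
    1# + 0#              ≈⟨ +-identityʳ 1# ⟩
    1#                   ∎
  eval-^ f (suc n) x = trans (eval-* f (f ^ₚ n) x) (*-congˡ (eval-^ f n x))

  eval-Λ : ∀ N x → evalℤ (Λ p N) x ≈ x * (x - 1#) ^ (N ∸ 1)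
  eval-Λ N x = begin
    evalℤ (Λ p N) x                                    ≈⟨ eval-* U ((U -ₚ 1ₚ) ^ₚ (N ∸ 1)) x ⟩
    evalℤ U x * evalℤ ((U -ₚ 1ₚ) ^ₚ (N ∸ 1)) x
      ≈⟨ *-cong eval-U (eval-^ (U -ₚ 1ₚ) (N ∸ 1) x) ⟩
    x * evalℤ (U -ₚ 1ₚ) x ^ (N ∸ 1)                    ≈⟨ *-congˡ (^-congˡ (N ∸ 1) eval-U-1) ⟩
    x * (x - 1#) ^ (N ∸ 1)                             ∎
    where
    eval-U : evalℤ U x ≈ x
    eval-U = begin
      0# + x * (ι R (+ 1) + x * 0#)   ≈⟨ +-congˡ (*-congˡ (+-congʳ ι-1)) ⟩
      0# + x * (1# + x * 0#)
        ≈⟨ solve 2 (λ x o → con (+ 0) :+ x :* (o :+ x :* con (+ 0)) := x :* o) refl x 1# ⟩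
      x * 1#                          ≈⟨ *-identityʳ x ⟩
      x                               ∎
    eval-U-1 : evalℤ (U -ₚ 1ₚ) x ≈ x - 1#
    eval-U-1 = begin
      - ι R (+ 1) + x * (ι R (+ 1) + x * 0#)
        ≈⟨ +-cong (-‿cong ι-1) (*-congˡ (+-congʳ ι-1)) ⟩
      - 1# + x * (1# + x * 0#)
        ≈⟨ solve 2 (λ x o → :- o :+ x :* (o :+ x :* con (+ 0)) := x :* o :- o) refl x 1# ⟩
      x * 1# - 1#                     ≈⟨ +-congʳ (*-identityʳ x) ⟩
      x - 1#                          ∎

  -- Coefficients and degree of `Λ`.

  coeff-+ : ∀ f g i → coeff (f +ₚ g) i ≡ coeff f i ℤ.+ coeff g i
  coeff-+ []      g       i       = ≡.sym (ℤ.+-identityˡ _)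
  coeff-+ (a ∷ f) []      i       = ≡.sym (ℤ.+-identityʳ _)
  coeff-+ (a ∷ f) (b ∷ g) zero    = ≡.refl
  coeff-+ (a ∷ f) (b ∷ g) (suc i) = coeff-+ f g i

  coeff-scale : ∀ a f i → coeff (map (a ℤ.*_) f) i ≡ a ℤ.* coeff f i
  coeff-scale a []      i       = ≡.sym (ℤ.*-zeroʳ a)
  coeff-scale a (b ∷ f) zero    = ≡.refl
  coeff-scale a (b ∷ f) (suc i) = coeff-scale a f i

  coeff-linear-* : ∀ a b g i →
    coeff ((a ∷ b ∷ []) *ₚ g) (suc i) ≡ a ℤ.* coeff g (suc i) ℤ.+ b ℤ.* coeff g i
  coeff-linear-* a b g i = ≡.trans (coeff-+ (map (a ℤ.*_) g) _ (suc i))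
    (≡.cong₂ ℤ._+_ (coeff-scale a g (suc i)) (≡.trans (coeff-+ (map (b ℤ.*_) g) _ i)
      (≡.trans (≡.cong₂ ℤ._+_ (coeff-scale b g i) (coeff-[0] i)) (ℤ.+-identityʳ _))))
    where
    coeff-[0] : ∀ i → coeff (+ 0 ∷ []) i ≡ + 0
    coeff-[0] zero    = ≡.refl
    coeff-[0] (suc _) = ≡.refl

  -- Equality of integers rather than congruence modulo `p`: `ι` carries it to any ring, whereas it
  -- respects congruence only when p · 1 = 0 there.
  Monic : ℕ → Poly → Set
  Monic d f = coeff f d ≡ + 1 × (∀ i → d < i → coeff f i ≡ + 0)

  monic-linear-* : ∀ {d} a g → Monic d g → Monic (suc d) ((a ∷ + 1 ∷ []) *ₚ g)
  monic-linear-* {d} a g (top , above) = leading , higher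
    where
    leading : coeff ((a ∷ + 1 ∷ []) *ₚ g) (suc d) ≡ + 1
    leading = ≡.trans (coeff-linear-* a (+ 1) g d)
      (≡.cong₂ (λ u v → u ℤ.+ + 1 ℤ.* v)
        (≡.trans (≡.cong (a ℤ.*_) (above (suc d) (ℕ.n<1+n d))) (ℤ.*-zeroʳ a)) top)
    higher : ∀ i → suc d < i → coeff ((a ∷ + 1 ∷ []) *ₚ g) i ≡ + 0
    higher (suc i) (ℕ.s≤s d<i) = ≡.trans (coeff-linear-* a (+ 1) g i)
      (≡.cong₂ (λ u v → u ℤ.+ + 1 ℤ.* v)
        (≡.trans (≡.cong (a ℤ.*_) (above (suc i) (ℕ.m<n⇒m<1+n d<i))) (ℤ.*-zeroʳ a)) (above i d<i))

  monic-^ : ∀ a n → Monic n ((a ∷ + 1 ∷ []) ^ₚ n)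
  monic-^ a zero    = ≡.refl , λ { (suc i) _ → ≡.refl }
  monic-^ a (suc n) = monic-linear-* a ((a ∷ + 1 ∷ []) ^ₚ n) (monic-^ a n)

  coeff-baseChange : ∀ f i → R.coeff (baseChange R p f) i ≡ ι R (coeff f i)
  coeff-baseChange []      i       = ≡.refl
  coeff-baseChange (a ∷ f) zero    = ≡.refl
  coeff-baseChange (a ∷ f) (suc i) = coeff-baseChange f i

  monic⇒hasDegree : ¬ (1# ≈ 0#) → ∀ {d} f → Monic d f → R.HasDegree (baseChange R p f) d
  monic⇒hasDegree 1≉0 {d} f (top , above) =
    (λ eq → 1≉0 (trans (sym (trans (coeff-ι d top) ι-1)) eq)) ,
    λ i d<i → coeff-ι i (above i d<i)
    where
    coeff-ι : ∀ i {z} → coeff f i ≡ z → R.coeff (baseChange R p f) i ≈ ι R z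
    coeff-ι i eq = reflexive (≡.trans (coeff-baseChange f i) (≡.cong (ι R) eq))

  Λ-hasDegree : ¬ (1# ≈ 0#) → ∀ n → R.HasDegree (baseChange R p (Λ p (suc n))) (suc n)
  Λ-hasDegree 1≉0 n =
    monic⇒hasDegree 1≉0 (Λ p (suc n)) (monic-linear-* (+ 0) ((U -ₚ 1ₚ) ^ₚ n) (monic-^ (ℤ.- + 1) n))

private variable
  ℓ ℓᵃ ℓᵇ ℓʳ : Level

-- Counting

length-filter-∁ : {A : Set ℓᵃ} {P : Pred A ℓ} (P? : Decidable P) (xs : List A) →
  length (filter P? xs) ℕ.+ length (filter (¬? ∘ P?) xs) ≡ length xs
length-filter-∁ P? [] = ≡.refl
length-filter-∁ P? (x ∷ xs) with P? x
... | yes _ = ≡.cong suc (length-filter-∁ P? xs)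
... | no  _ = ≡.trans (ℕ.+-suc _ _) (≡.cong suc (length-filter-∁ P? xs))

module _ {S : Setoid ℓᵃ ℓ} {B : Set ℓᵇ} {_R_ : REL (Setoid.Carrier S) B ℓʳ}
  (R? : Binary.Decidable _R_) where

  -- The pigeonhole behind all the counting, by induction on `ys`: at most `k` elements are related
  -- to the head, and the others are covered by the tail. With `k = 1` it turns an injective
  -- relation into an inequality of lengths.
  length-≤-fibres : ∀ k → (∀ y {zs} → Unique S zs → All (_R y) zs → length zs ≤ k) →
    ∀ {xs} ys → Unique S xs → All (λ x → Any (x R_) ys) xs → length xs ≤ length ys ℕ.* k
  length-≤-fibres k fibre {[]}    []       _   _        = z≤n
  length-≤-fibres k fibre {_ ∷ _} []       _   (() ∷ _)
  length-≤-fibres k fibre {xs}    (y ∷ ys) xs! covered  = begin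
    length xs                                    ≡⟨ length-filter-∁ Ry? xs ⟨
    length (filter Ry? xs) ℕ.+ length rest
      ≤⟨ ℕ.+-mono-≤ (fibre y (Unique.filter⁺ S Ry? xs!) (All.all-filter Ry? xs))
           (length-≤-fibres k fibre ys (Unique.filter⁺ S (¬? ∘ Ry?) xs!) rest-covered) ⟩
    k ℕ.+ length ys ℕ.* k                        ∎
    where
    open ℕ.≤-Reasoning
    Ry? = λ x → R? x y
    rest = filter (¬? ∘ Ry?) xs
    rest-covered : All (λ x → Any (x R_) ys) rest
    rest-covered = All.zipWith (λ (¬xRy , any) → Any.tail ¬xRy any)
      (All.all-filter (¬? ∘ Ry?) xs , All.filter⁺ (¬? ∘ Ry?) covered)

module _ (S : Setoid ℓᵃ ℓ) where
  open Setoid S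
  open Data.List.Membership.Setoid S using (_∈_)

  length-≤1 : ∀ {xs} → Unique S xs → (∀ {x y} → x ∈ xs → y ∈ xs → x ≈ y) → length xs ≤ 1
  length-≤1 {[]}        _                  _     = z≤n
  length-≤1 {_ ∷ []}    _                  _     = s≤s z≤n
  length-≤1 {_ ∷ _ ∷ _} ((x≉y ∷ _) ∷ _) equal =
    contradiction (equal (here refl) (there (here refl))) x≉y

  lookup-injective : ∀ {xs} → Unique S xs → ∀ i j → lookup xs i ≈ lookup xs j → i ≡ j
  lookup-injective (_   ∷ _)   zero    zero    _  = ≡.refl
  lookup-injective (x∉  ∷ _)   zero    (suc j) eq =
    contradiction eq (All.lookup x∉ (Membership.∈-lookup (≡.setoid _) _ j))
  lookup-injective (x∉  ∷ _)   (suc i) zero    eq =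
    contradiction (sym eq) (All.lookup x∉ (Membership.∈-lookup (≡.setoid _) _ i))
  lookup-injective (_   ∷ xs!) (suc i) (suc j) eq = ≡.cong suc (lookup-injective xs! i j eq)

  -- Makes the numbering of a value set independent of the preimage through which a value is
  -- presented.
  index-cong : ∀ {x y xs} → Unique S xs → (x∈ : x ∈ xs) (y∈ : y ∈ xs) → x ≈ y →
    Any.index x∈ ≡ Any.index y∈
  index-cong xs! x∈ y∈ x≈y = lookup-injective xs! _ _
    (trans (sym (Any.lookup-index x∈)) (trans x≈y (Any.lookup-index y∈)))

-- Polynomial functions and their roots

module PolynomialFunctions {c ℓ} (R : CommutativeRing c ℓ) where
  open CommutativeRing R
  open IntegerImage R
  open import Algebra.Properties.Ring ring using (x∙y⁻¹≈ε⇒x≈y)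
  open import Algebra.Properties.Semiring.Exp semiring using (_^_)
  open import Relation.Binary.Reasoning.Setoid setoid
  open Solver using (solve; _:=_; _:+_; _:*_; _:-_)

  -- horner b (a₀ ∷ … ∷ a_{d-1}) x = a₀ + … + a_{d-1} x^{d-1} + b x^d
  horner : ∀ {d} → Carrier → Vec Carrier d → Carrier → Carrier
  horner b []       x = b
  horner b (a ∷ as) x = a + x * horner b as x

  -- The coefficients of (f(x) - f(r)) / (x - r), by synthetic division.
  quotient : ∀ {d} → Carrier → Carrier → Vec Carrier (suc d) → Vec Carrier d
  quotient {zero}  b r (a ∷ [])          = []
  quotient {suc d} b r (a ∷ as@(_ ∷ _)) = horner b as r ∷ quotient b r as

  horner-quotient : ∀ {d} b r (as : Vec Carrier (suc d)) x →
    horner b as x - horner b as r ≈ (x - r) * horner b (quotient b r as) x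
  horner-quotient {zero} b r (a ∷ []) x =
    solve 4 (λ a b x r → (a :+ x :* b) :- (a :+ r :* b) := (x :- r) :* b) refl a b x r
  horner-quotient {suc d} b r (a ∷ as@(_ ∷ _)) x = begin
    (a + x * fx) - (a + r * fr)
      ≈⟨ solve 5 (λ a x r u v → (a :+ x :* u) :- (a :+ r :* v) := (x :- r) :* v :+ x :* (u :- v))
           refl a x r fx fr ⟩
    (x - r) * fr + x * (fx - fr)
      ≈⟨ +-congˡ (*-congˡ (horner-quotient b r as x)) ⟩
    (x - r) * fr + x * ((x - r) * q)
      ≈⟨ solve 4 (λ x r v q → (x :- r) :* v :+ x :* ((x :- r) :* q) := (x :- r) :* (v :+ x :* q))
           refl x r fr q ⟩
    (x - r) * (fr + x * q) ∎
    where
    fx = horner b as x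
    fr = horner b as r
    q = horner b (quotient b r as) x

  -- The coefficient `b` of x^d stands apart because root counting asks only that it be nonzero. It
  -- may be `0#`, so a summand of lower degree can be raised to degree `d` and added without
  -- disturbing it.
  IsPolynomial : ℕ → Carrier → (Carrier → Carrier) → Set _
  IsPolynomial d b f = ∃[ as ] (∀ x → f x ≈ horner {d} b as x)

  isPolynomial-+ : ∀ {d b b′ f g} → IsPolynomial d b f → IsPolynomial d b′ g →
    IsPolynomial d (b + b′) (λ x → f x + g x)
  isPolynomial-+ {b = b} {b′} (as , f≈) (as′ , g≈) = zipWith _+_ as as′ ,
    λ x → trans (+-cong (f≈ x) (g≈ x)) (horner-+ as as′ x)
    where
    horner-+ : ∀ {d} (as as′ : Vec Carrier d) x →
      horner b as x + horner b′ as′ x ≈ horner (b + b′) (zipWith _+_ as as′) x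
    horner-+ []       []         x = refl
    horner-+ (a ∷ as) (a′ ∷ as′) x = trans
      (solve 5 (λ a a′ x u v → (a :+ x :* u) :+ (a′ :+ x :* v) := (a :+ a′) :+ x :* (u :+ v))
        refl a a′ x _ _)
      (+-congˡ (*-congˡ (horner-+ as as′ x)))

  isPolynomial-raise : ∀ {d b f} → IsPolynomial d b f → IsPolynomial (suc d) 0# f
  isPolynomial-raise {b = b} (as , f≈) = as ∷ʳ b , λ x → trans (f≈ x) (horner-∷ʳ as x)
    where
    horner-∷ʳ : ∀ {d} (as : Vec Carrier d) x → horner b as x ≈ horner 0# (as ∷ʳ b) x
    horner-∷ʳ []       x = sym (trans (+-congˡ (zeroʳ x)) (+-identityʳ b))
    horner-∷ʳ (a ∷ as) x = +-congˡ (*-congˡ (horner-∷ʳ as x))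

  isPolynomial-< : ∀ {d d′ b f} → d < d′ → IsPolynomial d b f → IsPolynomial d′ 0# f
  isPolynomial-< {d} {f = f} d<d′ poly = go (ℕ.≤⇒≤′ d<d′)
    where
    go : ∀ {d′} → suc d ≤′ d′ → IsPolynomial d′ 0# f
    go (≤′-reflexive ≡.refl) = isPolynomial-raise poly
    go (≤′-step d<d′)        = isPolynomial-raise (go d<d′)

  isPolynomial-^ : ∀ d → IsPolynomial d 1# (_^ d)
  isPolynomial-^ d = replicate d 0# , horner-^ d
    where
    horner-^ : ∀ d x → x ^ d ≈ horner 1# (replicate d 0#) x
    horner-^ zero    x = refl
    horner-^ (suc d) x = trans (*-congˡ (horner-^ d x)) (sym (+-identityˡ _))

  isPolynomial-resp : ∀ {d b b′ f} → b ≈ b′ → IsPolynomial d b f → IsPolynomial d b′ f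
  isPolynomial-resp {b = b} {b′} b≈b′ (as , f≈) = as , λ x → trans (f≈ x) (horner-cong as x)
    where
    horner-cong : ∀ {d} (as : Vec Carrier d) x → horner b as x ≈ horner b′ as x
    horner-cong []       x = b≈b′
    horner-cong (a ∷ as) x = +-congˡ (*-congˡ (horner-cong as x))

  module _ (x*y≈0⇒y≈0 : ∀ {x y} → ¬ (x ≈ 0#) → x * y ≈ 0# → y ≈ 0#) where

    -- Dividing by x - r keeps the leading coefficient `b` and lowers the degree by one. The
    -- remaining roots differ from `r`, so without zero divisors they are roots of the quotient.
    length-roots-horner : ∀ {d b} → ¬ (b ≈ 0#) → (as : Vec Carrier d) →
      ∀ {rs} → Unique setoid rs → All (λ r → horner b as r ≈ 0#) rs → length rs ≤ d
    length-roots-horner b≉0 as       []           []             = z≤n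
    length-roots-horner b≉0 []       (_ ∷ _)      (b≈0 ∷ _)      = contradiction b≈0 b≉0
    length-roots-horner {b = b} b≉0 as@(_ ∷ _) {r ∷ _} (r∉rs ∷ rs!) (fr≈0 ∷ roots) =
      s≤s (length-roots-horner b≉0 (quotient b r as) rs! (All.zipWith root-quotient (r∉rs , roots)))
      where
      root-quotient : ∀ {x} → ¬ (r ≈ x) × horner b as x ≈ 0# → horner b (quotient b r as) x ≈ 0#
      root-quotient {x} (r≉x , fx≈0) =
        x*y≈0⇒y≈0 (λ x-r≈0 → r≉x (sym (x∙y⁻¹≈ε⇒x≈y x r x-r≈0))) (begin
          (x - r) * horner b (quotient b r as) x   ≈⟨ horner-quotient b r as x ⟨
          horner b as x - horner b as r            ≈⟨ +-cong fx≈0 (-‿cong fr≈0) ⟩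
          0# - 0#                                  ≈⟨ -‿inverseʳ 0# ⟩
          0#                                       ∎)

    length-roots : ∀ {d b f} → IsPolynomial d b f → ¬ (b ≈ 0#) →
      ∀ {rs} → Unique setoid rs → All (λ r → f r ≈ 0#) rs → length rs ≤ d
    length-roots (as , f≈) b≉0 rs! roots =
      length-roots-horner b≉0 as rs! (All.map (λ fr≈0 → trans (sym (f≈ _)) fr≈0) roots)

-- The Frobenius endomorphism

module _ {p} (p-prime : Prime p) where

  private
    1<p : 1 < p
    1<p = ℕ.nonTrivial⇒n>1 p {{prime⇒nonTrivial p-prime}}

  prime∣!⇒≤ : ∀ k → p ∣ k ! → p ≤ k
  prime∣!⇒≤ zero    p∣1 = contradiction (ℕ.≤-reflexive (∣1⇒≡1 p∣1)) (ℕ.<⇒≱ 1<p)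
  prime∣!⇒≤ (suc k) p∣  with euclidsLemma (suc k) (k !) p-prime p∣
  ... | inj₁ p∣1+k = ∣⇒≤ p∣1+k
  ... | inj₂ p∣k!  = ℕ.m≤n⇒m≤1+n (prime∣!⇒≤ k p∣k!)

  -- `p` divides p! = (p C k) k! (p - k)!, but neither of the two factorials, since both are of
  -- numbers below `p`.
  prime∣C : ∀ {k} → 0 < k → k < p → p ∣ p C k
  prime∣C {k} 0<k k<p with euclidsLemma (p C k) (k ! ℕ.* (p ∸ k) !) p-prime p∣C*
    where
    instance
      _ = ℕ.m*n≢0 (k !) ((p ∸ k) !) {{k ℕ.!≢0}} {{(p ∸ k) ℕ.!≢0}}
    C*≡! : (p C k) ℕ.* (k ! ℕ.* (p ∸ k) !) ≡ p !
    C*≡! = ≡.trans (≡.cong (ℕ._* (k ! ℕ.* (p ∸ k) !)) (nCk≡n!/k![n-k]! (ℕ.<⇒≤ k<p)))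
      (m/n*n≡m (k![n∸k]!∣n! (ℕ.<⇒≤ k<p)))
    p∣! : ∀ {p} → 1 < p → p ∣ p !
    p∣! {suc p} _ = m∣m*n (p !)
    p∣C* : p ∣ (p C k) ℕ.* (k ! ℕ.* (p ∸ k) !)
    p∣C* = ≡.subst (p ∣_) (≡.sym C*≡!) (p∣! 1<p)
  ... | inj₁ p∣C = p∣C
  ... | inj₂ p∣k!*[p-k]! with euclidsLemma (k !) ((p ∸ k) !) p-prime p∣k!*[p-k]!
  ...   | inj₁ p∣k!     = contradiction (prime∣!⇒≤ k p∣k!) (ℕ.<⇒≱ k<p)
  ...   | inj₂ p∣[p-k]! = contradiction (prime∣!⇒≤ (p ∸ k) p∣[p-k]!)
                            (ℕ.<⇒≱ (ℕ.∸-monoʳ-< 0<k (ℕ.<⇒≤ k<p)))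

module _ {c ℓ} (R : CommutativeRing c ℓ) where
  open CommutativeRing R hiding (zero)
  open Algebra.Properties.Semiring.Exp semiring
  open import Relation.Binary.Reasoning.Setoid setoid

  IsAdditiveExponent : ℕ → Set _
  IsAdditiveExponent N = ∀ x y → (x + y) ^ N ≈ x ^ N + y ^ N

  isAdditiveExponent-^ : ∀ {N} → IsAdditiveExponent N → ∀ i → IsAdditiveExponent (N ℕ.^ i)
  isAdditiveExponent-^ {N} N-additive zero    x y =
    trans (*-identityʳ _) (sym (+-cong (*-identityʳ x) (*-identityʳ y)))
  isAdditiveExponent-^ {N} N-additive (suc i) x y = begin
    (x + y) ^ (N ℕ.* N ℕ.^ i)        ≈⟨ ^-assocʳ (x + y) N (N ℕ.^ i) ⟨
    ((x + y) ^ N) ^ (N ℕ.^ i)        ≈⟨ ^-congˡ (N ℕ.^ i) (N-additive x y) ⟩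
    (x ^ N + y ^ N) ^ (N ℕ.^ i)      ≈⟨ isAdditiveExponent-^ N-additive i (x ^ N) (y ^ N) ⟩
    (x ^ N) ^ (N ℕ.^ i) + (y ^ N) ^ (N ℕ.^ i)
      ≈⟨ +-cong (^-assocʳ x N (N ℕ.^ i)) (^-assocʳ y N (N ℕ.^ i)) ⟩
    x ^ (N ℕ.* N ℕ.^ i) + y ^ (N ℕ.* N ℕ.^ i) ∎

module Frobenius {c ℓ} (R : CommutativeRing c ℓ) where
  open CommutativeRing R hiding (zero)
  open import Algebra.Properties.CommutativeSemiring.Exp commutativeSemiring
  open import Algebra.Properties.Semiring.Mult semiring
    using (×-congʳ; ×-assocˡ; ×-homo-1; ×-assoc-*) renaming (_×_ to _·_)
  open import Relation.Binary.Reasoning.Setoid setoid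
  private
    module Σ = Algebra.Properties.CommutativeMonoid.Sum +-commutativeMonoid

  module _ {p} (p-prime : Prime p) (p·1≈0 : p · 1# ≈ 0#) where

    ∣⇒·≈0 : ∀ {n} → p ∣ n → ∀ x → n · x ≈ 0#
    ∣⇒·≈0 {n} (divides k ≡.refl) x = begin
      (k ℕ.* p) · x            ≈⟨ ×-congʳ (k ℕ.* p) (*-identityˡ x) ⟨
      (k ℕ.* p) · (1# * x)     ≈⟨ ×-assoc-* (k ℕ.* p) 1# x ⟨
      ((k ℕ.* p) · 1#) * x     ≈⟨ *-congʳ (×-assocˡ 1# k p) ⟨
      (k · (p · 1#)) * x       ≈⟨ *-congʳ (×-congʳ k p·1≈0) ⟩
      (k · 0#) * x             ≈⟨ ×-assoc-* k 0# x ⟩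
      k · (0# * x)             ≈⟨ ×-congʳ k (zeroˡ x) ⟩
      k · 0#                   ≈⟨ Σ.sum-replicate k ⟨
      Σ.sum {k} (λ _ → 0#)     ≈⟨ Σ.sum-replicate-zero k ⟩
      0#                       ∎

    -- In the binomial expansion all terms but the first and the last have a coefficient divisible
    -- by `p`.
    ^p-homo-+ : IsAdditiveExponent R p
    ^p-homo-+ x y = go p ≡.refl
      where
      open Algebra.Properties.CommutativeSemiring.Binomial commutativeSemiring
        using (theorem; binomialTerm)
      go : ∀ n → p ≡ n → (x + y) ^ n ≈ x ^ n + y ^ n
      go zero    ≡.refl = contradiction (ℕ.nonTrivial⇒n>1 p {{prime⇒nonTrivial p-prime}}) λ ()
      go (suc n) ≡.refl = begin
        (x + y) ^ suc n                                        ≈⟨ theorem (suc n) x y ⟩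
        t zero + Σ.sum (t ∘ suc)
          ≈⟨ +-congˡ (sum-init-last +-monoid (t ∘ suc)) ⟩
        t zero + (Σ.sum (t ∘ suc ∘ inject₁) + t (suc (fromℕ n)))
          ≈⟨ +-cong first (+-cong (trans (Σ.sum-cong-≋ middle) (Σ.sum-replicate-zero n)) last) ⟩
        y ^ suc n + (0# + x ^ suc n)                           ≈⟨ +-congˡ (+-identityˡ _) ⟩
        y ^ suc n + x ^ suc n                                  ≈⟨ +-comm _ _ ⟩
        x ^ suc n + y ^ suc n                                  ∎
        where
        t = binomialTerm x y (suc n)
        first : t zero ≈ y ^ suc n
        first = trans (×-homo-1 _) (*-identityˡ _)
        middle : ∀ i → t (suc (inject₁ i)) ≈ 0#
        middle i = ∣⇒·≈0 (prime∣C p-prime (s≤s z≤n)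
          (s≤s (≡.subst (_< n) (≡.sym (Fin.toℕ-inject₁ i)) (Fin.toℕ<n i)))) _
        last : t (suc (fromℕ n)) ≈ x ^ suc n
        last rewrite Fin.toℕ-fromℕ n | nCn≡1 (suc n) | ℕ.n∸n≡0 n = trans (×-homo-1 _) (*-identityʳ _)

module _ {c ℓ} (M : CommutativeMonoid c ℓ) where
  open CommutativeMonoid M
  open Algebra.Properties.CommutativeMonoid.Sum M

  sum-single : ∀ {n} (f : Fin n → Carrier) i → (∀ j → j ≢ i → f j ≈ ε) → sum f ≈ f i
  sum-single {suc n} f zero    f≈ε = trans
    (∙-congˡ (trans (sum-cong-≋ (λ j → f≈ε (suc j) λ ())) (sum-replicate-zero n))) (identityʳ _)
  sum-single {suc n} f (suc i) f≈ε = trans (∙-congʳ (f≈ε zero λ ()))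
    (trans (identityˡ _) (sum-single (f ∘ suc) i λ j j≢i → f≈ε (suc j) (j≢i ∘ Fin.suc-injective)))

-- Finite fields

module FiniteField {c ℓ₁ ℓ₂} (F : HeytingField c ℓ₁ ℓ₂) {q}
  (card : HasCardinality (CommutativeRing.setoid (toCommutativeRing F)) q) where

  private
    R = toCommutativeRing F
  open CommutativeRing R hiding (zero; _≉_)
  open IntegerImage R
  open Inverse card using () renaming
    ( to to index; from to enum; to-cong to index-resp
    ; strictlyInverseˡ to index-enum; strictlyInverseʳ to enum-index)
  open Solver using (solve; _:=_; _:+_; _:*_; _:-_)
  open import Algebra.Properties.Ring ring using (x∙y⁻¹≈ε⇒x≈y; -0#≈0#)
  open import Algebra.Properties.CommutativeSemiring.Exp commutativeSemiring
  open import Algebra.Properties.Semiring.Mult semiring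
    using (×-homo-1; ×1-homo-*) renaming (_×_ to _·_)
  open import Relation.Binary.Reasoning.Setoid setoid
  open import Data.List.Membership.Setoid setoid using (_∈_)
  private
    module Σ = Algebra.Properties.CommutativeMonoid.Sum +-commutativeMonoid
    module Π = Algebra.Properties.CommutativeMonoid.Sum *-commutativeMonoid

  infix 4 _≟_ _≉_
  _≉_ : Carrier → Carrier → Set ℓ₁
  x ≉ y = ¬ (x ≈ y)

  index-injective : ∀ {x y} → index x ≡ index y → x ≈ y
  index-injective {x} {y} eq =
    trans (sym (enum-index x)) (trans (reflexive (≡.cong enum eq)) (enum-index y))

  _≟_ : ∀ x y → Dec (x ≈ y)
  x ≟ y = map′ index-injective index-resp (index x Fin.≟ index y)

  ∃? : ∀ {ℓ} {P : Pred Carrier ℓ} → (∀ {x y} → x ≈ y → P x → P y) → Decidable P → Dec (∃[ x ] P x)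
  ∃? resp P? = map′ (λ (i , Pi) → enum i , Pi) (λ (x , Px) → index x , resp (sym (enum-index x)) Px)
    (Fin.any? (P? ∘ enum))

  elements : List Carrier
  elements = tabulate enum

  length-elements : length elements ≡ q
  length-elements = List.length-tabulate enum

  elements-unique : Unique setoid elements
  elements-unique = Unique.tabulate⁺ setoid λ {i} {j} eq →
    ≡.trans (≡.sym (index-enum i)) (≡.trans (index-resp eq) (index-enum j))

  ∈-elements : ∀ x → x ∈ elements
  ∈-elements x = Membership.∈-resp-≈ setoid (enum-index x) (Membership.∈-tabulate⁺ setoid (index x))

  length-unique : ∀ {xs} → Unique setoid xs → length xs ≤ q
  length-unique {xs} xs! = ℕ.≤-trans
    (length-≤-fibres {S = setoid} _≟_ 1
      (λ y zs! zs≈y → length-≤1 setoid zs! λ x∈ y∈ →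
        trans (All.lookupₛ setoid (λ x≈y x≈ → trans (sym x≈y) x≈) zs≈y x∈)
          (sym (All.lookupₛ setoid (λ x≈y x≈ → trans (sym x≈y) x≈) zs≈y y∈)))
      elements xs! (All.universal ∈-elements xs))
    (ℕ.≤-reflexive (≡.trans (ℕ.*-identityʳ _) length-elements))

  -- If 1 ≈ 0 then 0 - 0 is invertible, so 0 would be apart from itself.
  1≉0 : 1# ≉ 0#
  1≉0 1≈0 = HeytingField.#-irrefl F refl (HeytingField.invertible⇒# F {0#} {0#}
    (1# , trans (*-identityˡ _) 0-0≈1 , trans (*-identityʳ _) 0-0≈1))
    where
    0-0≈1 : 0# - 0# ≈ 1#
    0-0≈1 = trans (-‿inverseʳ 0#) (sym 1≈0)

  -- Apartness is not given as decidable, so the inverse is found by searching the finite carrier.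
  -- Were there none, `x` could not be apart from 0, and tightness would force x ≈ 0.
  inverse : ∀ {x} → x ≉ 0# → ∃[ y ] y * x ≈ 1#
  inverse {x} x≉0 with ∃? (λ y≈z yx≈1 → trans (*-congʳ (sym y≈z)) yx≈1) (λ y → y * x ≟ 1#)
  ... | yes inv = inv
  ... | no ¬inv = contradiction (proj₁ (HeytingField.tight F x 0#) ¬x#0) x≉0
    where
    ¬x#0 : ¬ HeytingField._#_ F x 0#
    ¬x#0 x#0 with HeytingField.#⇒invertible F x#0
    ... | y , y*[x-0]≈1 , _ =
      ¬inv (y , trans (*-congˡ (sym (trans (+-congˡ -0#≈0#) (+-identityʳ x)))) y*[x-0]≈1)

  x*y≈0⇒y≈0 : ∀ {x y} → x ≉ 0# → x * y ≈ 0# → y ≈ 0#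
  x*y≈0⇒y≈0 {x} {y} x≉0 xy≈0 with inverse x≉0
  ... | x⁻¹ , x⁻¹x≈1 = begin
    y               ≈⟨ *-identityˡ y ⟨
    1# * y          ≈⟨ *-congʳ x⁻¹x≈1 ⟨
    (x⁻¹ * x) * y   ≈⟨ *-assoc _ _ _ ⟩
    x⁻¹ * (x * y)   ≈⟨ *-congˡ xy≈0 ⟩
    x⁻¹ * 0#        ≈⟨ zeroʳ x⁻¹ ⟩
    0#              ∎

  *-cancelˡ : ∀ {x y z} → x ≉ 0# → x * y ≈ x * z → y ≈ z
  *-cancelˡ {x} {y} {z} x≉0 xy≈xz = x∙y⁻¹≈ε⇒x≈y y z (x*y≈0⇒y≈0 x≉0 (begin
    x * (y - z)      ≈⟨ solve 3 (λ x y z → x :* (y :- z) := x :* y :- x :* z) refl x y z ⟩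
    x * y - x * z    ≈⟨ +-congʳ xy≈xz ⟩
    x * z - x * z    ≈⟨ -‿inverseʳ _ ⟩
    0#               ∎))

  1^n≈1 : ∀ n → 1# ^ n ≈ 1#
  1^n≈1 zero    = refl
  1^n≈1 (suc n) = trans (*-identityˡ _) (1^n≈1 n)

  0^n≈0 : ∀ {n} → 0 < n → 0# ^ n ≈ 0#
  0^n≈0 {suc n} _ = zeroˡ _

  x^n≉0 : ∀ {x} n → x ≉ 0# → x ^ n ≉ 0#
  x^n≉0 zero    x≉0 eq = 1≉0 eq
  x^n≉0 (suc n) x≉0 eq = x^n≉0 n x≉0 (x*y≈0⇒y≈0 x≉0 eq)

  product≉0 : ∀ {n} (f : Fin n → Carrier) → (∀ i → f i ≉ 0#) → Π.sum f ≉ 0#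
  product≉0 {zero}  f f≉0 eq = 1≉0 eq
  product≉0 {suc n} f f≉0 eq = product≉0 (f ∘ suc) (f≉0 ∘ suc) (x*y≈0⇒y≈0 (f≉0 zero) eq)

  -- Moves a bijection of the field to the index set, where sums and products over all elements can
  -- be permuted.
  conjugate : (f g : Carrier → Carrier) →
    (∀ {x y} → x ≈ y → f x ≈ f y) → (∀ {x y} → x ≈ y → g x ≈ g y) →
    (∀ x → f (g x) ≈ x) → (∀ x → g (f x) ≈ x) → Permutation q q
  conjugate f g f-cong g-cong fg gf = permutation (index ∘ f ∘ enum) (index ∘ g ∘ enum)
    (λ i → ≡.trans (index-resp (trans (f-cong (enum-index _)) (fg (enum i)))) (index-enum i))
    (λ i → ≡.trans (index-resp (trans (g-cong (enum-index _)) (gf (enum i)))) (index-enum i))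

  -- Translation by 1 permutes the field, so the sum S of all elements satisfies S = q · 1 + S.
  q·1≈0 : q · 1# ≈ 0#
  q·1≈0 = begin
    q · 1#                                  ≈⟨ Σ.sum-replicate q ⟨
    Σ.sum {q} (λ _ → 1#)                    ≈⟨ solve 2 (λ a s → a := (a :+ s) :- s) refl _ _ ⟩
    (Σ.sum {q} (λ _ → 1#) + Σ.sum enum) - Σ.sum enum
      ≈⟨ +-congʳ (Σ.∑-distrib-+ (λ _ → 1#) enum) ⟨
    Σ.sum (λ i → 1# + enum i) - Σ.sum enum
      ≈⟨ +-congʳ (Σ.sum-cong-≋ {q} (λ i → enum-index (1# + enum i))) ⟨
    Σ.sum (enum ∘ (Perm._⟨$⟩ʳ_ π)) - Σ.sum enum
      ≈⟨ +-congʳ (Σ.sum-permute enum π) ⟨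
    Σ.sum enum - Σ.sum enum                 ≈⟨ -‿inverseʳ _ ⟩
    0#                                      ∎
    where
    π = conjugate (λ x → 1# + x) (λ x → x - 1#) +-congˡ +-congʳ
      (λ x → solve 2 (λ o x → o :+ (x :- o) := x) refl 1# x)
      (λ x → solve 2 (λ o x → (o :+ x) :- o := x) refl 1# x)

  -- The characteristic is read off the number of elements: (p · 1)^m = q · 1 = 0, and a field has
  -- no nonzero nilpotents.
  p·1≈0 : ∀ p m → q ≡ p ℕ.^ m → p · 1# ≈ 0#
  p·1≈0 p m ≡.refl with p · 1# ≟ 0#
  ... | yes eq = eq
  ... | no neq = contradiction (trans (sym (^·1 m)) q·1≈0) (x^n≉0 m neq)
    where
    ^·1 : ∀ m → (p ℕ.^ m) · 1# ≈ (p · 1#) ^ m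
    ^·1 zero    = ×-homo-1 1#
    ^·1 (suc m) = trans (×1-homo-* p (p ℕ.^ m)) (*-congˡ (^·1 m))

  -- The product of the nonzero elements is invariant under multiplication by x.
  x^q≈x : 0 < q → ∀ x → x ^ q ≈ x
  x^q≈x 0<q x with x ≟ 0#
  ... | yes x≈0 = trans (^-congˡ q x≈0) (trans (0^n≈0 0<q) (sym x≈0))
  ... | no  x≉0 = begin
    x ^ q                                              ≈⟨ Π.sum-replicate q ⟨
    Π.sum {q} (λ _ → x)                                ≈⟨ Π.sum-cong-≋ {q} (λ i → sym (split (enum i))) ⟩
    Π.sum {q} (λ i → off (enum i) * at (enum i))       ≈⟨ Π.∑-distrib-+ {q} (off ∘ enum) (at ∘ enum) ⟩
    Π.sum (off ∘ enum) * Π.sum (at ∘ enum)             ≈⟨ *-cong Πoff≈1 Πat≈x ⟩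
    1# * x                                             ≈⟨ *-identityˡ x ⟩
    x                                                  ∎
    where
    ite : Carrier → Carrier → Carrier → Carrier
    ite u v y with y ≟ 0#
    ... | yes _ = u
    ... | no  _ = v
    ite-0 : ∀ {u v y} → y ≈ 0# → ite u v y ≈ u
    ite-0 {y = y} y≈0 with y ≟ 0#
    ... | yes _   = refl
    ... | no  y≉0 = contradiction y≈0 y≉0
    ite-≉0 : ∀ {u v y} → y ≉ 0# → ite u v y ≈ v
    ite-≉0 {y = y} y≉0 with y ≟ 0#
    ... | yes y≈0 = contradiction y≈0 y≉0
    ... | no  _   = refl
    -- Products run over all q elements, so zero has to be masked. `off` contributes a factor x at
    -- each nonzero element and `at` the one remaining factor x at zero; this splits x^q into
    -- x^(q-1), which is shown to be 1, times x. `nonzero` replaces zero by 1 so that the product to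
    -- be cancelled does not vanish.
    off at nonzero : Carrier → Carrier
    off = ite 1# x
    at = ite x 1#
    nonzero y = ite 1# y y
    split : ∀ y → off y * at y ≈ x
    split y with y ≟ 0#
    ... | yes _ = *-identityˡ x
    ... | no  _ = *-identityʳ x
    nonzero≉0 : ∀ y → nonzero y ≉ 0#
    nonzero≉0 y with y ≟ 0#
    ... | yes _   = 1≉0
    ... | no  y≉0 = y≉0
    nonzero-cong : ∀ {y z} → y ≈ z → nonzero y ≈ nonzero z
    nonzero-cong {y} {z} y≈z with y ≟ 0#
    ... | yes y≈0 = sym (ite-0 (trans (sym y≈z) y≈0))
    ... | no  y≉0 = trans y≈z (sym (ite-≉0 (λ z≈0 → y≉0 (trans y≈z z≈0))))
    nonzero-* : ∀ y → nonzero (x * y) ≈ off y * nonzero y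
    nonzero-* y with y ≟ 0#
    ... | yes y≈0 = trans (ite-0 (trans (*-congˡ y≈0) (zeroʳ x))) (sym (*-identityˡ 1#))
    ... | no  y≉0 = ite-≉0 (λ xy≈0 → y≉0 (x*y≈0⇒y≈0 x≉0 xy≈0))
    x⁻¹ = proj₁ (inverse x≉0)
    x⁻¹x≈1 = proj₂ (inverse x≉0)
    π = conjugate (x *_) (x⁻¹ *_) *-congˡ *-congˡ
      (λ y → trans (solve 3 (λ x x′ y → x :* (x′ :* y) := (x′ :* x) :* y) refl x x⁻¹ y)
        (trans (*-congʳ x⁻¹x≈1) (*-identityˡ y)))
      (λ y → trans (sym (*-assoc _ _ _)) (trans (*-congʳ x⁻¹x≈1) (*-identityˡ y)))
    nonzero-π : ∀ i → nonzero (enum (π Perm.⟨$⟩ʳ i)) ≈ off (enum i) * nonzero (enum i)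
    nonzero-π i = trans (nonzero-cong (enum-index (x * enum i))) (nonzero-* (enum i))
    P = Π.sum (nonzero ∘ enum)
    Πoff≈1 : Π.sum (off ∘ enum) ≈ 1#
    Πoff≈1 = *-cancelˡ (product≉0 (nonzero ∘ enum) (nonzero≉0 ∘ enum)) (begin
      P * Π.sum (off ∘ enum)                           ≈⟨ *-comm _ _ ⟩
      Π.sum (off ∘ enum) * P                           ≈⟨ Π.∑-distrib-+ (off ∘ enum) (nonzero ∘ enum) ⟨
      Π.sum (λ i → off (enum i) * nonzero (enum i))    ≈⟨ Π.sum-cong-≋ {q} nonzero-π ⟨
      Π.sum (nonzero ∘ enum ∘ (Perm._⟨$⟩ʳ_ π))         ≈⟨ Π.sum-permute (nonzero ∘ enum) π ⟨
      P                                                ≈⟨ *-identityʳ P ⟨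
      P * 1#                                           ∎)
    Πat≈x : Π.sum (at ∘ enum) ≈ x
    Πat≈x = trans
      (sum-single *-commutativeMonoid (at ∘ enum) (index 0#) λ j j≢ →
        ite-≉0 λ ej≈0 → j≢ (≡.trans (≡.sym (index-enum j)) (index-resp ej≈0)))
      (ite-0 (enum-index 0#))

-- The trace and the missed values

module MissedValues {c ℓ₁ ℓ₂} (F : HeytingField c ℓ₁ ℓ₂) (n k : ℕ) (0<n : 0 < n)
  (card : HasCardinality (CommutativeRing.setoid (toCommutativeRing F)) (suc n ℕ.^ suc k))
  (^N-homo-+ : IsAdditiveExponent (toCommutativeRing F) (suc n)) where

  private
    R = toCommutativeRing F
    N M : ℕ
    N = suc n
    M = N ℕ.^ k

  open CommutativeRing R hiding (zero; _≉_)
  open Algebra.Properties.CommutativeSemiring.Exp commutativeSemiring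
  open FiniteField F card
  open PolynomialFunctions R
  open IntegerImage R
  open Solver using (solve; _:=_; _:+_; _:*_; _:-_; :-_; con)
  open import Algebra.Properties.Ring ring using (x∙y⁻¹≈ε⇒x≈y)
  open import Relation.Binary.Reasoning.Setoid setoid
  open import Data.List.Membership.Setoid setoid using (lose)

  private
    instance
      M≢0 : ℕ.NonZero M
      M≢0 = ℕ.m^n≢0 N k

    N^i<N^1+i : ∀ i → N ℕ.^ i < N ℕ.^ suc i
    N^i<N^1+i i = ℕ.^-monoʳ-< N (s≤s 0<n) (ℕ.n<1+n i)

  x^q : ∀ x → x ^ (N ℕ.^ suc k) ≈ x
  x^q = x^q≈x (ℕ.>-nonZero⁻¹ (N ℕ.^ suc k) {{ℕ.m^n≢0 N (suc k)}})

  additive⇒homo-- : ∀ {f : Carrier → Carrier} → (∀ {x y} → x ≈ y → f x ≈ f y) →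
    (∀ x y → f (x + y) ≈ f x + f y) → ∀ x y → f (x - y) ≈ f x - f y
  additive⇒homo-- {f} f-cong f-+ x y = begin
    f (x - y)                   ≈⟨ solve 2 (λ u v → u := (u :+ v) :- v) refl _ _ ⟩
    (f (x - y) + f y) - f y     ≈⟨ +-congʳ (f-+ (x - y) y) ⟨
    f ((x - y) + y) - f y       ≈⟨ +-congʳ (f-cong (solve 2 (λ x y → (x :- y) :+ y := x) refl x y)) ⟩
    f x - f y                   ∎

  ^N-homo-- : ∀ x y → (x - y) ^ N ≈ x ^ N - y ^ N
  ^N-homo-- = additive⇒homo-- (^-congˡ N) ^N-homo-+

  -- The sum x + x^N + ... with `j` terms. For j = k + 1 it is the trace from 𝔽_Q to 𝔽_N; general
  -- `j` is there for induction.
  trace : ℕ → Carrier → Carrier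
  trace zero    x = 0#
  trace (suc j) x = trace j x + x ^ (N ℕ.^ j)

  trace-cong : ∀ j {x y} → x ≈ y → trace j x ≈ trace j y
  trace-cong zero    x≈y = refl
  trace-cong (suc j) x≈y = +-cong (trace-cong j x≈y) (^-congˡ (N ℕ.^ j) x≈y)

  trace-+ : ∀ j x y → trace j (x + y) ≈ trace j x + trace j y
  trace-+ zero    x y = sym (+-identityʳ 0#)
  trace-+ (suc j) x y = trans (+-cong (trace-+ j x y) (isAdditiveExponent-^ R ^N-homo-+ j x y))
    (solve 4 (λ a b u v → (a :+ b) :+ (u :+ v) := (a :+ u) :+ (b :+ v)) refl _ _ _ _)

  trace-^N : ∀ j x → trace j x ^ N ≈ trace j (x ^ N)
  trace-^N zero    x = 0^n≈0 {N} (s≤s z≤n)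
  trace-^N (suc j) x = trans (^N-homo-+ _ _) (+-cong (trace-^N j x) (begin
    (x ^ (N ℕ.^ j)) ^ N     ≈⟨ ^-assocʳ x (N ℕ.^ j) N ⟩
    x ^ (N ℕ.^ j ℕ.* N)     ≈⟨ ^-congʳ x (ℕ.*-comm (N ℕ.^ j) N) ⟩
    x ^ (N ℕ.* N ℕ.^ j)     ≈⟨ ^-assocʳ x N (N ℕ.^ j) ⟨
    (x ^ N) ^ (N ℕ.^ j)     ∎))

  trace-telescope : ∀ j x → trace j (x ^ N) - trace j x ≈ x ^ (N ℕ.^ j) - x
  trace-telescope zero    x =
    trans (-‿inverseʳ 0#) (sym (trans (+-congʳ (*-identityʳ x)) (-‿inverseʳ x)))
  trace-telescope (suc j) x = begin
    (trace j (x ^ N) + (x ^ N) ^ (N ℕ.^ j)) - (trace j x + x ^ (N ℕ.^ j))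
      ≈⟨ solve 4 (λ a b u v → (a :+ b) :- (u :+ v) := b :+ ((a :- u) :- v)) refl _ _ _ _ ⟩
    (x ^ N) ^ (N ℕ.^ j) + ((trace j (x ^ N) - trace j x) - x ^ (N ℕ.^ j))
      ≈⟨ +-cong (^-assocʳ x N (N ℕ.^ j)) (+-congʳ (trace-telescope j x)) ⟩
    x ^ (N ℕ.* N ℕ.^ j) + ((x ^ (N ℕ.^ j) - x) - x ^ (N ℕ.^ j))
      ≈⟨ solve 3 (λ a b x → a :+ ((b :- x) :- b) := a :- x) refl _ _ x ⟩
    x ^ (N ℕ.* N ℕ.^ j) - x ∎

  -- Linearity over 𝔽_N: an `a` with a^N = a is fixed by all iterates of the N-th power.
  trace-* : ∀ {a} → a ^ N ≈ a → ∀ j x → trace j (a * x) ≈ a * trace j x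
  trace-* {a} a^N≈a = go
    where
    a^N^i≈a : ∀ i → a ^ (N ℕ.^ i) ≈ a
    a^N^i≈a zero    = *-identityʳ a
    a^N^i≈a (suc i) = trans (sym (^-assocʳ a N (N ℕ.^ i)))
      (trans (^-congˡ (N ℕ.^ i) a^N≈a) (a^N^i≈a i))
    go : ∀ j x → trace j (a * x) ≈ a * trace j x
    go zero    x = sym (zeroʳ a)
    go (suc j) x = begin
      trace j (a * x) + (a * x) ^ (N ℕ.^ j)
        ≈⟨ +-cong (go j x) (trans (^-distrib-* a x (N ℕ.^ j)) (*-congʳ (a^N^i≈a j))) ⟩
      a * trace j x + a * x ^ (N ℕ.^ j)
        ≈⟨ distribˡ a _ _ ⟨
      a * (trace j x + x ^ (N ℕ.^ j)) ∎

  trace-isPolynomial : ∀ j → IsPolynomial (N ℕ.^ j) 1# (trace (suc j))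
  trace-isPolynomial j =
    isPolynomial-resp (+-identityˡ 1#) (isPolynomial-+ (lower j) (isPolynomial-^ (N ℕ.^ j)))
    where
    -- The terms before x^(N^j) have degree below N^j because N > 1, so they add 0 to the leading
    -- coefficient. For j = 0 the zero function counts as degree N^0 = 1 with leading coefficient 0.
    lower : ∀ j → IsPolynomial (N ℕ.^ j) 0# (trace j)
    lower zero    = isPolynomial-raise {b = 0#} ([] , λ _ → refl)
    lower (suc j) = isPolynomial-< (N^i<N^1+i j) (trace-isPolynomial j)

  Tr : Carrier → Carrier
  Tr = trace (suc k)

  Tr-cong : ∀ {x y} → x ≈ y → Tr x ≈ Tr y
  Tr-cong = trace-cong (suc k)

  Tr-0 : Tr 0# ≈ 0#
  Tr-0 = trans (Tr-cong (sym (-‿inverseʳ 0#)))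
    (trans (additive⇒homo-- Tr-cong (trace-+ (suc k)) 0# 0#) (-‿inverseʳ _))

  ψ : Carrier → Carrier
  ψ w = w ^ N - w

  ψ-cong : ∀ {x y} → x ≈ y → ψ x ≈ ψ y
  ψ-cong x≈y = +-cong (^-congˡ N x≈y) (-‿cong x≈y)

  Tr-ψ : ∀ w → Tr (ψ w) ≈ 0#
  Tr-ψ w = begin
    Tr (w ^ N - w)              ≈⟨ additive⇒homo-- Tr-cong (trace-+ (suc k)) (w ^ N) w ⟩
    Tr (w ^ N) - Tr w           ≈⟨ trace-telescope (suc k) w ⟩
    w ^ (N ℕ.^ suc k) - w       ≈⟨ +-congʳ (x^q w) ⟩
    w - w                       ≈⟨ -‿inverseʳ w ⟩
    0#                          ∎

  -- Places the values of `Tr` in 𝔽_N: the N-th power commutes with `Tr`, and Tr (x^N) - Tr x = Tr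
  -- (ψ x) = 0.
  Tr^N≈Tr : ∀ x → Tr x ^ N ≈ Tr x
  Tr^N≈Tr x = trans (trace-^N (suc k) x) (x∙y⁻¹≈ε⇒x≈y _ _
    (trans (sym (additive⇒homo-- Tr-cong (trace-+ (suc k)) (x ^ N) x)) (Tr-ψ x)))

  length-Tr-fibre : ∀ a {xs} → Unique setoid xs → All (λ x → Tr x ≈ a) xs → length xs ≤ M
  length-Tr-fibre a xs! Tr≈a = length-roots x*y≈0⇒y≈0
    (isPolynomial-resp (+-identityʳ 1#)
      (isPolynomial-+ (trace-isPolynomial k) (constant (ℕ.>-nonZero⁻¹ M))))
    1≉0 xs! (All.map (λ Trx≈a → trans (+-congʳ Trx≈a) (-‿inverseʳ a)) Tr≈a)
    where
    constant : ∀ {d} → 0 < d → IsPolynomial d 0# (λ _ → - a)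
    constant 0<d = isPolynomial-< 0<d ([] , λ _ → refl)

  length-ψ-fibre : ∀ a {xs} → Unique setoid xs → All (λ x → ψ x ≈ a) xs → length xs ≤ N
  length-ψ-fibre a xs! ψ≈a = length-roots x*y≈0⇒y≈0
    (isPolynomial-resp (+-identityʳ 1#) (isPolynomial-+ (isPolynomial-^ N) linear))
    1≉0 xs! (All.map root ψ≈a)
    where
    linear : IsPolynomial N 0# (λ x → - x - a)
    -- N > 1 keeps -x - a below degree N, so that `ψ` - a stays monic.
    linear = isPolynomial-< (s≤s 0<n) (- a ∷ [] , λ x → begin
      - x - a                ≈⟨ +-congʳ (-‿cong (*-identityʳ x)) ⟨
      - (x * 1#) - a         ≈⟨ solve 3 (λ x o a → :- (x :* o) :- a := :- a :+ x :* :- o) refl x 1# a ⟩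
      - a + x * - 1#         ∎)
    root : ∀ {x} → ψ x ≈ a → x ^ N + (- x - a) ≈ 0#
    root {x} ψx≈a = begin
      x ^ N + (- x - a)      ≈⟨ +-assoc _ _ _ ⟨
      ψ x - a                ≈⟨ +-congʳ ψx≈a ⟩
      a - a                  ≈⟨ -‿inverseʳ a ⟩
      0#                     ∎

  -- The N M elements of the field fall into fibres of size at most N. It is used twice: with `a` of
  -- trace 1 to count the elements of trace 1, and with a = 0 to show that the image of `ψ` fills
  -- the kernel of `Tr`.
  M≤length-ψ-translate : ∀ a ys → (∀ w → Any (λ y → ψ w + a ≈ y) ys) → M ≤ length ys
  M≤length-ψ-translate a ys covered = ℕ.*-cancelʳ-≤ M (length ys) N (ℕ.≤-trans
    (ℕ.≤-reflexive (≡.trans (ℕ.*-comm M N) (≡.sym length-elements)))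
    (length-≤-fibres {S = setoid} (λ w y → ψ w + a ≟ y) N
      (λ y zs! fibre → length-ψ-fibre (y - a) zs! (All.map subtract fibre))
      ys elements-unique (All.universal covered elements)))
    where
    subtract : ∀ {w y} → ψ w + a ≈ y → ψ w ≈ y - a
    subtract eq = trans (solve 2 (λ u a → u := (u :+ a) :- a) refl _ a) (+-congʳ eq)

  -- The inverse `a` of Tr v lies in 𝔽_N because Tr v does: (Tr v)^N a^N = 1 = Tr v * a = (Tr v)^N
  -- a, and (Tr v)^N cancels.
  Tr≉0⇒normalise : ∀ {v} → Tr v ≉ 0# → ∃[ a ] a ^ N ≈ a × a * Tr v ≈ 1#
  Tr≉0⇒normalise {v} Trv≉0 with inverse Trv≉0
  ... | a , a*Trv≈1 = a , *-cancelˡ (x^n≉0 N Trv≉0) (begin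
      Tr v ^ N * a ^ N      ≈⟨ *-comm _ _ ⟩
      a ^ N * Tr v ^ N      ≈⟨ ^-distrib-* a (Tr v) N ⟨
      (a * Tr v) ^ N        ≈⟨ ^-congˡ N a*Trv≈1 ⟩
      1# ^ N                ≈⟨ 1^n≈1 N ⟩
      1#                    ≈⟨ a*Trv≈1 ⟨
      a * Tr v              ≈⟨ *-comm _ _ ⟩
      Tr v * a              ≈⟨ *-congʳ (Tr^N≈Tr v) ⟨
      Tr v ^ N * a          ∎) , a*Trv≈1

  -- `Tr` has degree M < Q, so it cannot vanish at all Q elements.
  ¬Tr≈0 : ¬ (∀ x → Tr x ≈ 0#)
  ¬Tr≈0 Tr≈0 = ℕ.<⇒≱ (N^i<N^1+i k) (≡.subst (_≤ M) length-elements
    (length-Tr-fibre 0# elements-unique (All.universal Tr≈0 elements)))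

  Tr-surjective : ∃[ θ ] Tr θ ≈ 1#
  Tr-surjective =
    go (∃? (λ x≈y Trx≉0 Try≈0 → Trx≉0 (trans (Tr-cong x≈y) Try≈0)) (λ x → ¬? (Tr x ≟ 0#)))
    where
    go : Dec (∃[ v ] Tr v ≉ 0#) → ∃[ θ ] Tr θ ≈ 1#
    go (yes (v , Trv≉0)) = let a , a^N≈a , a*Trv≈1 = Tr≉0⇒normalise Trv≉0 in
      a * v , trans (trace-* a^N≈a (suc k) v) a*Trv≈1
    go (no ¬∃) = contradiction
      (λ x → decidable-stable (Tr x ≟ 0#) λ Trx≉0 → ¬∃ (x , Trx≉0)) ¬Tr≈0

  any-select : ∀ {ℓ ℓ′} {P : Pred Carrier ℓ} {Q : Pred Carrier ℓ′} (P? : Decidable P) →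
    (∀ {x y} → x ≈ y → P x → P y) → (∀ {x y} → x ≈ y → Q x → Q y) →
    ∀ {x} → P x → Q x → Any Q (filter P? elements)
  any-select P? P-resp Q-resp Px Qx =
    lose Q-resp (Membership.∈-filter⁺ setoid P? P-resp (∈-elements _) Px) Qx

  Tr≈1? : Decidable (λ v → Tr v ≈ 1#)
  Tr≈1? v = Tr v ≟ 1#

  trace-one : List Carrier
  trace-one = filter Tr≈1? elements

  trace-one-unique : Unique setoid trace-one
  trace-one-unique = Unique.filter⁺ setoid Tr≈1? elements-unique

  length-trace-one : length trace-one ≡ M
  length-trace-one = ℕ.≤-antisym
    (length-Tr-fibre 1# trace-one-unique (All.all-filter Tr≈1? elements))
    (M≤length-ψ-translate θ trace-one λ w →
      any-select Tr≈1? (λ x≈y → trans (Tr-cong (sym x≈y))) (λ x≈y eq → trans eq x≈y)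
        (trans (trace-+ (suc k) (ψ w) θ) (trans (+-cong (Tr-ψ w) Trθ≈1) (+-identityˡ 1#))) refl)
    where
    θ = proj₁ Tr-surjective
    Trθ≈1 = proj₂ Tr-surjective

  Imψ? : Decidable (λ v → ∃[ w ] ψ w ≈ v)
  Imψ? v = ∃? (λ x≈y → trans (ψ-cong (sym x≈y))) (λ w → ψ w ≟ v)

  -- The image of `ψ` already supplies at least M distinct zeros of `Tr`. A zero outside the image
  -- would be one more than the degree M allows.
  Tr≈0⇒ψ : ∀ {v} → Tr v ≈ 0# → ∃[ w ] ψ w ≈ v
  Tr≈0⇒ψ {v} Trv≈0 = decidable-stable (Imψ? v) λ v∉Im → ℕ.<⇒≱ (s≤s M≤length-Imψ)
    (length-Tr-fibre 0# (All.map (λ (w , ψw≈y) v≈y → v∉Im (w , trans ψw≈y (sym v≈y))) in-image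
      ∷ Unique.filter⁺ setoid Imψ? elements-unique)
    (Trv≈0 ∷ All.map (λ (w , ψw≈y) → trans (Tr-cong (sym ψw≈y)) (Tr-ψ w)) in-image))
    where
    in-image : All (λ v → ∃[ w ] ψ w ≈ v) (filter Imψ? elements)
    in-image = All.all-filter Imψ? elements
    M≤length-Imψ : M ≤ length (filter Imψ? elements)
    M≤length-Imψ = M≤length-ψ-translate 0# (filter Imψ? elements) λ w →
      any-select Imψ? (λ x≈y (w , eq) → w , trans eq x≈y) (λ x≈y eq → trans eq x≈y)
        (w , refl) (+-identityʳ _)

  -- Values and missed values of `λN`.

  λN : Carrier → Carrier
  λN x = x * (x - 1#) ^ n

  λN-cong : ∀ {x y} → x ≈ y → λN x ≈ λN y
  λN-cong x≈y = *-cong x≈y (^-congˡ n (+-congʳ x≈y))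

  IsValue : Pred Carrier _
  IsValue y = ∃[ x ] λN x ≈ y

  IsValue-resp : ∀ {y z} → y ≈ z → IsValue y → IsValue z
  IsValue-resp y≈z (x , eq) = x , trans eq y≈z

  isValue? : Decidable IsValue
  isValue? y = ∃? (λ x≈z → trans (λN-cong (sym x≈z))) (λ x → λN x ≟ y)

  -- The substitution x = 1 + 1/s.
  affine⇒isValue : ∀ {y s} → y * s ^ N - s ≈ 1# → IsValue y
  affine⇒isValue {y} {s} eq = x , (begin
    x * (x - 1#) ^ n
      ≈⟨ *-congˡ (^-congˡ n (solve 2 (λ t o → (o :+ t) :- o := t) refl t 1#)) ⟩
    (1# + t) * t ^ n               ≈⟨ *-congʳ (+-congʳ ts≈1) ⟨
    (t * s + t) * t ^ n            ≈⟨ *-congʳ (+-congˡ (*-identityʳ t)) ⟨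
    (t * s + t * 1#) * t ^ n       ≈⟨ *-congʳ (distribˡ t s 1#) ⟨
    (t * (s + 1#)) * t ^ n         ≈⟨ *-congʳ (*-congˡ s+1≈) ⟩
    (t * (y * s ^ N)) * t ^ n
      ≈⟨ solve 4 (λ t y u v → (t :* (y :* u)) :* v := y :* ((t :* v) :* u)) refl _ _ _ _ ⟩
    y * (t ^ N * s ^ N)            ≈⟨ *-congˡ (^-distrib-* t s N) ⟨
    y * (t * s) ^ N                ≈⟨ *-congˡ (^-congˡ N ts≈1) ⟩
    y * 1# ^ N                     ≈⟨ *-congˡ (1^n≈1 N) ⟩
    y * 1#                         ≈⟨ *-identityʳ y ⟩
    y                              ∎)
    where
    s≉0 : s ≉ 0#
    s≉0 s≈0 = 1≉0 (begin
      1#                 ≈⟨ eq ⟨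
      y * s ^ N - s      ≈⟨ +-cong (*-congˡ (trans (^-congˡ N s≈0) (0^n≈0 {N} (s≤s z≤n)))) (-‿cong s≈0) ⟩
      y * 0# - 0#        ≈⟨ solve 1 (λ y → y :* con (+ 0) :- con (+ 0) := con (+ 0)) refl y ⟩
      0#                 ∎)
    t = proj₁ (inverse s≉0)
    ts≈1 = proj₂ (inverse s≉0)
    x = 1# + t
    s+1≈ : s + 1# ≈ y * s ^ N
    s+1≈ = trans (+-congˡ (sym eq)) (solve 2 (λ s u → s :+ (u :- s) := u) refl s _)

  Tr≈1⇒≉0 : ∀ {v} → Tr v ≈ 1# → v ≉ 0#
  Tr≈1⇒≉0 Trv≈1 v≈0 = 1≉0 (trans (sym Trv≈1) (trans (Tr-cong v≈0) Tr-0))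

  -- The substitution is run backwards: a preimage x of v^n has x ≠ 1, since v^n ≠ 0, and s = 1/(x -
  -- 1) gives ψ (v s) = v, which would make Tr v = 0.
  Tr≈1⇒missed : ∀ {v} → Tr v ≈ 1# → ¬ IsValue (v ^ n)
  Tr≈1⇒missed {v} Trv≈1 (x , λx≈v^n) =
    1≉0 (trans (sym Trv≈1) (trans (Tr-cong (sym (ψ≈v (inverse t≉0)))) (Tr-ψ _)))
    where
    t = x - 1#
    t≉0 : t ≉ 0#
    t≉0 t≈0 = x^n≉0 n (Tr≈1⇒≉0 Trv≈1) (begin
      v ^ n         ≈⟨ λx≈v^n ⟨
      x * t ^ n     ≈⟨ *-congˡ (trans (^-congˡ n t≈0) (0^n≈0 0<n)) ⟩
      x * 0#        ≈⟨ zeroʳ x ⟩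
      0#            ∎)
    ψ≈v : ((s , _) : ∃[ s ] s * t ≈ 1#) → ψ (v * s) ≈ v
    ψ≈v (s , st≈1) = begin
      (v * s) ^ N - v * s
        ≈⟨ +-congʳ (^-distrib-* v s N) ⟩
      (v * v ^ n) * (s * s ^ n) - v * s
        ≈⟨ +-congʳ (*-congʳ (*-congˡ λx≈v^n)) ⟨
      (v * (x * t ^ n)) * (s * s ^ n) - v * s
        ≈⟨ +-congʳ (solve 5 (λ v x s a b → (v :* (x :* a)) :* (s :* b) := (v :* x :* s) :* (b :* a))
             refl v x s _ _) ⟩
      (v * x * s) * (s ^ n * t ^ n) - v * s
        ≈⟨ +-congʳ (*-congˡ (trans (sym (^-distrib-* s t n)) (trans (^-congˡ n st≈1) (1^n≈1 n)))) ⟩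
      (v * x * s) * 1# - v * s
        -- Exposes s (x - 1) = 1. The identity must hold for every `o` in place of `1#`, hence the
        -- compensating term (s o) o.
        ≈⟨ solve 4 (λ v x s o →
                      (v :* x :* s) :* o :- v :* s := v :* ((s :* (x :- o)) :* o :+ (s :* o) :* o :- s))
             refl v x s 1# ⟩
      v * ((s * t) * 1# + (s * 1#) * 1# - s)
        ≈⟨ *-congˡ (+-congʳ (+-cong (*-congʳ st≈1) (trans (*-identityʳ _) (*-identityʳ s)))) ⟩
      v * (1# * 1# + s - s)
        ≈⟨ *-congˡ (+-congʳ (+-congʳ (*-identityˡ 1#))) ⟩
      v * (1# + s - s)
        ≈⟨ *-congˡ (solve 2 (λ o s → o :+ s :- s := o) refl 1# s) ⟩
      v * 1#
        ≈⟨ *-identityʳ v ⟩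
      v ∎

  -- The quotient a = v / v′ has a^n = 1, hence lies in 𝔽_N, and linearity of the trace gives a = a
  -- * Tr v′ = Tr (a v′) = Tr v = 1.
  ^n-injective-on-Tr≈1 : ∀ {v v′} → Tr v ≈ 1# → Tr v′ ≈ 1# → v ^ n ≈ v′ ^ n → v ≈ v′
  ^n-injective-on-Tr≈1 {v} {v′} Trv≈1 Trv′≈1 v^n≈v′^n = go (inverse (Tr≈1⇒≉0 Trv′≈1))
    where
    go : ∃[ u ] u * v′ ≈ 1# → v ≈ v′
    go (u , uv′≈1) = begin
      v                ≈⟨ *-identityʳ v ⟨
      v * 1#           ≈⟨ *-congˡ uv′≈1 ⟨
      v * (u * v′)     ≈⟨ *-assoc v u v′ ⟨
      a * v′           ≈⟨ *-congʳ a≈1 ⟩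
      1# * v′          ≈⟨ *-identityˡ v′ ⟩
      v′               ∎
      where
      a = v * u
      a^n≈1 : a ^ n ≈ 1#
      a^n≈1 = begin
        (v * u) ^ n        ≈⟨ ^-distrib-* v u n ⟩
        v ^ n * u ^ n      ≈⟨ *-congʳ v^n≈v′^n ⟩
        v′ ^ n * u ^ n     ≈⟨ *-comm _ _ ⟩
        u ^ n * v′ ^ n     ≈⟨ ^-distrib-* u v′ n ⟨
        (u * v′) ^ n       ≈⟨ ^-congˡ n uv′≈1 ⟩
        1# ^ n             ≈⟨ 1^n≈1 n ⟩
        1#                 ∎
      a^N≈a : a ^ N ≈ a
      a^N≈a = trans (*-congˡ a^n≈1) (*-identityʳ a)
      a≈1 : a ≈ 1#
      a≈1 = begin
        a              ≈⟨ *-identityʳ a ⟨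
        a * 1#         ≈⟨ *-congˡ Trv′≈1 ⟨
        a * Tr v′      ≈⟨ trace-* a^N≈a (suc k) v′ ⟨
        Tr (a * v′)    ≈⟨ Tr-cong (trans (*-assoc v u v′) (trans (*-congˡ uv′≈1) (*-identityʳ v))) ⟩
        Tr v           ≈⟨ Trv≈1 ⟩
        1#             ∎

  -- If y u^n ≠ 1 for all u, the additive map s ↦ y s^N - s has trivial kernel,
  -- so it is onto and takes the value 1.
  missed⇒y*u^n≈1 : ∀ {y} → ¬ IsValue y → ∃[ u ] y * u ^ n ≈ 1#
  missed⇒y*u^n≈1 {y} missed = decidable-stable
    (∃? (λ x≈z → trans (*-congˡ (^-congˡ n (sym x≈z)))) (λ u → y * u ^ n ≟ 1#)) λ ¬∃ →
      -- An injective `L` that omits 1 would make 1 and its values a list of Q + 1 distinct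
      -- elements.
      ℕ.<⇒≱ (s≤s (ℕ.≤-reflexive (≡.sym (≡.trans (List.length-map L elements) length-elements))))
        (length-unique (All.map⁺ (All.universal 1≉L elements)
          ∷ Unique.map⁺ setoid setoid (L-injective (λ u eq → ¬∃ (u , eq))) elements-unique))
    where
    L : Carrier → Carrier
    L s = y * s ^ N - s
    1≉L : ∀ s → ¬ (1# ≈ L s)
    1≉L s 1≈Ls = missed (affine⇒isValue (sym 1≈Ls))
    L-injective : (∀ u → y * u ^ n ≉ 1#) → ∀ {s s′} → L s ≈ L s′ → s ≈ s′
    L-injective y*u^n≉1 {s} {s′} Ls≈Ls′ = x∙y⁻¹≈ε⇒x≈y s s′
      -- With d = s - s′, additivity gives (y d^n - 1) d = L s - L s′ = 0, and the first factor is
      -- nonzero by assumption.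
      (x*y≈0⇒y≈0 (λ eq → y*u^n≉1 d (x∙y⁻¹≈ε⇒x≈y _ _ eq)) (begin
        (y * d ^ n - 1#) * d
          ≈⟨ solve 4 (λ y d u o → (y :* u :- o) :* d := y :* (d :* u) :- o :* d) refl y d _ 1# ⟩
        y * d ^ N - 1# * d
          ≈⟨ +-cong (*-congˡ (^N-homo-- s s′)) (-‿cong (*-identityˡ d)) ⟩
        y * (s ^ N - s′ ^ N) - d
          ≈⟨ solve 5 (λ y u v s s′ → y :* (u :- v) :- (s :- s′) := (y :* u :- s) :- (y :* v :- s′))
               refl y _ _ s s′ ⟩
        L s - L s′
          ≈⟨ +-congʳ Ls≈Ls′ ⟩
        L s′ - L s′
          ≈⟨ -‿inverseʳ _ ⟩
        0# ∎))
      where d = s - s′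

  missed⇒^n : ∀ {y} → ¬ IsValue y → ∃[ v ] Tr v ≈ 1# × v ^ n ≈ y
  missed⇒^n {y} missed = from-unit (missed⇒y*u^n≈1 missed)
    where
    from-unit : ∃[ u ] y * u ^ n ≈ 1# → ∃[ v ] Tr v ≈ 1# × v ^ n ≈ y
    from-unit (u , yu^n≈1) = rescale (inverse u≉0)
      where
      u≉0 : u ≉ 0#
      u≉0 u≈0 = 1≉0 (begin
        1#              ≈⟨ yu^n≈1 ⟨
        y * u ^ n       ≈⟨ *-congˡ (trans (^-congˡ n u≈0) (0^n≈0 0<n)) ⟩
        y * 0#          ≈⟨ zeroʳ y ⟩
        0#              ∎)
      rescale : ∃[ v ] v * u ≈ 1# → ∃[ v ] Tr v ≈ 1# × v ^ n ≈ y
      -- For v = 1/u one has v^n = y, and multiplying by a = 1 / Tr v makes the trace 1 without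
      -- changing the n-th power, as a^n = 1.
      rescale (v , vu≈1) = a * v , trans (trace-* a^N≈a (suc k) v) aTrv≈1 , (begin
        (a * v) ^ n      ≈⟨ ^-distrib-* a v n ⟩
        a ^ n * v ^ n    ≈⟨ *-cong a^n≈1 v^n≈y ⟩
        1# * y           ≈⟨ *-identityˡ y ⟩
        y                ∎)
        where
        v^n≈y : v ^ n ≈ y
        v^n≈y = begin
          v ^ n                    ≈⟨ *-identityˡ _ ⟨
          1# * v ^ n               ≈⟨ *-congʳ yu^n≈1 ⟨
          (y * u ^ n) * v ^ n      ≈⟨ *-assoc _ _ _ ⟩
          y * (u ^ n * v ^ n)      ≈⟨ *-congˡ (*-comm _ _) ⟩
          y * (v ^ n * u ^ n)      ≈⟨ *-congˡ (^-distrib-* v u n) ⟨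
          y * (v * u) ^ n          ≈⟨ *-congˡ (trans (^-congˡ n vu≈1) (1^n≈1 n)) ⟩
          y * 1#                   ≈⟨ *-identityʳ y ⟩
          y                        ∎
        -- If v = ψ w then s = w u satisfies y s^N - s = u (w^N - w) = 1.
        Trv≉0 : Tr v ≉ 0#
        Trv≉0 Trv≈0 = let w , ψw≈v = Tr≈0⇒ψ Trv≈0 in missed (affine⇒isValue (begin
          y * (w * u) ^ N - w * u
            ≈⟨ +-congʳ (*-congˡ (^-distrib-* w u N)) ⟩
          y * (w ^ N * (u * u ^ n)) - w * u
            ≈⟨ +-congʳ (solve 4 (λ y u a b → y :* (a :* (u :* b)) := (y :* b) :* (a :* u)) refl y u _ _) ⟩
          (y * u ^ n) * (w ^ N * u) - w * u
            ≈⟨ +-congʳ (trans (*-congʳ yu^n≈1) (*-identityˡ _)) ⟩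
          w ^ N * u - w * u
            ≈⟨ solve 3 (λ a w u → a :* u :- w :* u := (a :- w) :* u) refl _ w u ⟩
          ψ w * u
            ≈⟨ *-congʳ ψw≈v ⟩
          v * u
            ≈⟨ vu≈1 ⟩
          1# ∎))
        a = proj₁ (Tr≉0⇒normalise Trv≉0)
        a^N≈a : a ^ N ≈ a
        a^N≈a = proj₁ (proj₂ (Tr≉0⇒normalise Trv≉0))
        aTrv≈1 : a * Tr v ≈ 1#
        aTrv≈1 = proj₂ (proj₂ (Tr≉0⇒normalise Trv≉0))
        a≉0 : a ≉ 0#
        a≉0 a≈0 = 1≉0 (trans (sym aTrv≈1) (trans (*-congʳ a≈0) (zeroˡ _)))
        a^n≈1 : a ^ n ≈ 1#
        a^n≈1 = *-cancelˡ a≉0 (trans a^N≈a (sym (*-identityʳ a)))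

  isMissed? : Decidable (λ y → ¬ IsValue y)
  isMissed? = ¬? ∘ isValue?

  missedValues : List Carrier
  missedValues = filter isMissed? elements

  missedValues-unique : Unique setoid missedValues
  missedValues-unique = Unique.filter⁺ setoid isMissed? elements-unique

  length-missedValues : length missedValues ≡ M
  length-missedValues = ≡.trans (ℕ.≤-antisym missed≤ trace-one≤) length-trace-one
    where
    missed≤ : length missedValues ≤ length trace-one
    missed≤ = ≡.subst (length missedValues ≤_) (ℕ.*-identityʳ _)
      (length-≤-fibres {S = setoid} (λ y v → v ^ n ≟ y) 1
        (λ v zs! v^n≈ → length-≤1 setoid zs! λ x∈ y∈ →
          trans (sym (All.lookupₛ setoid (λ x≈z eq → trans eq x≈z) v^n≈ x∈))
            (All.lookupₛ setoid (λ x≈z eq → trans eq x≈z) v^n≈ y∈))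
        trace-one missedValues-unique
        (All.map (λ missed → let v , Trv≈1 , v^n≈y = missed⇒^n missed in
            any-select Tr≈1? (λ x≈z → trans (Tr-cong (sym x≈z)))
              (λ x≈z → trans (^-congˡ n (sym x≈z))) Trv≈1 v^n≈y)
          (All.all-filter isMissed? elements)))
    trace-one≤ : length trace-one ≤ length missedValues
    trace-one≤ = ≡.subst (length trace-one ≤_) (ℕ.*-identityʳ _)
      -- The trace condition is part of the relation because injectivity of the n-th power is known
      -- only between elements of trace 1.
      (length-≤-fibres {S = setoid} (λ v y → Tr v ≟ 1# ×-dec v ^ n ≟ y) 1
        (λ y zs! fibre → length-≤1 setoid zs! λ v∈ v′∈ →
          let Trv≈1 , v^n≈y = All.lookupₛ setoid fibre-resp fibre v∈
              Trv′≈1 , v′^n≈y = All.lookupₛ setoid fibre-resp fibre v′∈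
          in ^n-injective-on-Tr≈1 Trv≈1 Trv′≈1 (trans v^n≈y (sym v′^n≈y)))
        missedValues trace-one-unique
        (All.map (λ Trv≈1 → any-select isMissed?
              (λ x≈z missed value → missed (IsValue-resp (sym x≈z) value))
              (λ { x≈z (Trv≈1 , eq) → Trv≈1 , trans eq x≈z }) (Tr≈1⇒missed Trv≈1) (Trv≈1 , refl))
          (All.all-filter Tr≈1? elements)))
      where
      fibre-resp : ∀ {y v v′} → v ≈ v′ → Tr v ≈ 1# × v ^ n ≈ y → Tr v′ ≈ 1# × v′ ^ n ≈ y
      fibre-resp v≈v′ (Trv≈1 , v^n≈y) =
        trans (Tr-cong (sym v≈v′)) Trv≈1 , trans (^-congˡ n (sym v≈v′)) v^n≈y

  length-values : length (filter isValue? elements) ℕ.+ M ≡ N ℕ.^ suc k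
  length-values = ≡.trans
    (≡.cong (length (filter isValue? elements) ℕ.+_) (≡.sym length-missedValues))
    (≡.trans (length-filter-∁ isValue? elements) length-elements)

-- The bound and the cardinality of the value set

-- The division rounds down. With divisor n + 2, the number n + 1 + M (n + 2) has quotient M and
-- remainder n + 1 ≠ 0, so its negative is rounded to -(M + 1). Here `M` is one less than Q/N.
-[mn-1]/ℕn≡-m : ∀ M n →
  -[1+ n ℕ.+ M ℕ.* suc (suc n) ] ℤ./ℕ suc (suc n) ≡ -[1+ M ]
-[mn-1]/ℕn≡-m M n
  rewrite ≡.trans ([m+kn]%n≡m%n (suc n) M (suc (suc n))) (m<n⇒m%n≡m (ℕ.n<1+n (suc n)))
        | +-distrib-/-∣ʳ (suc n) {M ℕ.* suc (suc n)} {suc (suc n)} (n∣m*n M)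
        | m<n⇒m/n≡0 (ℕ.n<1+n (suc n))
        | m*n/n≡m M (suc (suc n)) {{_}} = ≡.refl

wanShiueChenBound-multiple : ∀ Q N M .{{_ : NonZero N}} → 1 < N → 0 < M → Q ≡ M ℕ.* N →
  wanShiueChenBound Q N ≡ + Q ℤ.- + M
wanShiueChenBound-multiple _ (suc (suc n)) (suc M) (s≤s (s≤s z≤n)) (s≤s z≤n) ≡.refl =
  -- The ceiling is the negated floor of the negation, so the numerator that is divided is -(Q - 1).
  ≡.cong (λ i → + Q ℤ.- ℤ.- i) (≡.trans
    (ℤ.div-pos-is-/ℕ -[1+ n ℕ.+ M ℕ.* suc (suc n) ] (suc (suc n))) (-[mn-1]/ℕn≡-m M n))
  where Q = suc M ℕ.* suc (suc n)

module _ {c ℓ} (R : CommutativeRing c ℓ) where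
  open CommutativeRing R
  open Polynomial R
  open Data.List.Membership.Setoid setoid using (_∈_)

  valueSet-cardinality : ∀ f {ys} → Unique setoid ys →
    (∀ {y} → ∃[ x ] eval f x ≈ y → y ∈ ys) → (∀ {y} → y ∈ ys → ∃[ x ] eval f x ≈ y) →
    HasCardinality (ValueSet f) (length ys)
  valueSet-cardinality f {ys} ys! complete sound = record
    { to        = λ (_ , value) → Any.index (complete value)
    ; from      = λ i → lookup ys i , sound (Membership.∈-lookup setoid ys i)
    ; to-cong   = λ {(_ , v)} {(_ , w)} → index-cong setoid ys! (complete v) (complete w)
    ; from-cong = λ { ≡.refl → refl }
    ; inverse   =
        (λ {i} {(_ , v)} y≈ → lookup-injective setoid ys! _ i
          (trans (sym (Any.lookup-index (complete v))) y≈)) ,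
        (λ { {(_ , v)} ≡.refl → sym (Any.lookup-index (complete v)) })
    }

open import Data.Nat.Base using (_^_)

-- The polynomial `Λ` over `F`.

module _ {c ℓ₁ ℓ₂} (F : HeytingField c ℓ₁ ℓ₂) {p} (p-prime : Prime p) where

  private
    R = toCommutativeRing F
  open CommutativeRing R hiding (zero)
  open Polynomial R

  Λ-F : ℕ → Poly
  Λ-F N = baseChange R p (Λ p N)

  -- Both 0 and 1 are roots, the latter because the exponent N - 1 is positive.
  Λ-not-permutation : ∀ {N} → 1 < N → ¬ (1# ≈ 0#) → ¬ IsPermutationPolynomial (Λ-F N)
  Λ-not-permutation {suc (suc n)} _ 1≉0 (injective , _) = 1≉0 (injective (trans Λ1≈0 (sym Λ0≈0)))
    where
    eval-Λ = BaseChange.eval-Λ R p (suc (suc n))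
    Λ0≈0 : eval (Λ-F (suc (suc n))) 0# ≈ 0#
    Λ0≈0 = trans (eval-Λ 0#) (zeroˡ _)
    Λ1≈0 : eval (Λ-F (suc (suc n))) 1# ≈ 0#
    Λ1≈0 = trans (eval-Λ 1#) (trans (*-congˡ (trans (*-congʳ (-‿inverseʳ 1#)) (zeroˡ _))) (zeroʳ 1#))
  Λ-not-permutation {suc zero} (s≤s ())

  valueSet-Λ : ∀ e k {n} → p ^ e ≡ suc n → 0 < n → HasCardinality setoid (suc n ^ suc k) →
    p ^ (suc k ℕ.* e) ≡ suc n ^ suc k →
    ∃[ l ] HasCardinality (ValueSet (Λ-F (suc n))) l × l ℕ.+ suc n ^ k ≡ suc n ^ suc k
  valueSet-Λ e k {n} N≡ 0<n card Q≡ = length (filter isValue? elements) ,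
    valueSet-cardinality R (Λ-F (suc n)) (Unique.filter⁺ setoid isValue? elements-unique)
      (λ (x , eq) → Membership.∈-filter⁺ setoid isValue? IsValue-resp (∈-elements _)
        (x , trans (sym (BaseChange.eval-Λ R p (suc n) x)) eq))
      (λ y∈ → let x , eq = proj₂ (Membership.∈-filter⁻ setoid isValue? IsValue-resp {xs = elements} y∈) in
        x , trans (BaseChange.eval-Λ R p (suc n) x) eq) ,
    length-values
    where
    p·1 = FiniteField.p·1≈0 F card p (suc k ℕ.* e) (≡.sym Q≡)
    ^N-homo-+ = ≡.subst (IsAdditiveExponent R) N≡
      (isAdditiveExponent-^ R (Frobenius.^p-homo-+ R p-prime p·1) e)
    open FiniteField F card
    open MissedValues F n k 0<n card
      ^N-homo-+

  Λ-values : ∀ e k N Q .{{_ : NonZero N}} → p ^ e ≡ N → p ^ (suc k ℕ.* e) ≡ Q →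
    Q ≡ N ^ suc k → 1 < N → HasCardinality setoid Q →
    ¬ IsPermutationPolynomial (Λ-F N) ×
    (∃[ l ] HasCardinality (ValueSet (Λ-F N)) l ×
            + l ≡ + Q ℤ.- + (Q / N) ×
            + Q ℤ.- + (Q / N) ≡ wanShiueChenBound Q N) ×
    AttainsWanShiueChenBound R Q (Λ-F N)
  Λ-values e k N@(suc n) Q N≡ Q≡ ≡.refl 1<N@(s≤s 0<n) card =
    let l , l-card , l+M≡Q = valueSet-Λ e k N≡ 0<n card Q≡
        l≡ = +l≡+Q-+Q/N l+M≡Q
    in not-permutation ,
       (l , l-card , l≡ , bound) ,
       not-permutation , N , _ , BaseChange.Λ-hasDegree R p 1≉0 n , l , l-card , ≡.trans l≡ bound
    where
    M = N ^ k
    1≉0 = FiniteField.1≉0 F card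
    not-permutation = Λ-not-permutation 1<N 1≉0
    Q≡M*N : Q ≡ M ℕ.* N
    Q≡M*N = ℕ.*-comm N M
    Q/N≡M : Q / N ≡ M
    Q/N≡M = ≡.trans (≡.cong (_/ N) Q≡M*N) (m*n/n≡m M N)
    bound : + Q ℤ.- + (Q / N) ≡ wanShiueChenBound Q N
    bound = ≡.trans (≡.cong (λ j → + Q ℤ.- + j) Q/N≡M)
      (≡.sym (wanShiueChenBound-multiple Q N M 1<N (ℕ.m^n>0 N k) Q≡M*N))
    +l≡+Q-+Q/N : ∀ {l} → l ℕ.+ M ≡ Q → + l ≡ + Q ℤ.- + (Q / N)
    +l≡+Q-+Q/N {l} l+M≡Q = begin
      + l                        ≡⟨ ≡.cong +_ (ℕ.m+n∸n≡m l M) ⟨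
      + (l ℕ.+ M ℕ.∸ M)          ≡⟨ ℤ.⊖-≥ (ℕ.m≤n+m M l) ⟨
      (l ℕ.+ M) ℤ.⊖ M            ≡⟨ ℤ.m-n≡m⊖n (l ℕ.+ M) M ⟨
      + (l ℕ.+ M) ℤ.- + M        ≡⟨ ≡.cong₂ (λ i j → + i ℤ.- + j) l+M≡Q (≡.sym Q/N≡M) ⟩
      + Q ℤ.- + (Q / N)          ∎
      where open ≡.≡-Reasoning

corollary5p6 :
    ∀ {c ℓ₁ ℓ₂} (p e m : ℕ) (p-prime : Prime p) → 1 ≤ e → 1 ≤ m → e ∣ m →
    (F : HeytingField c ℓ₁ ℓ₂) →
    let N = p ^ e
        Q = p ^ m
        instance N≢0 = primePower-nonZero p-prime e
        R = toCommutativeRing F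
        open Polynomial R
        Λ-F = baseChange R p (Λ p N)
    in
    HasCardinality (CommutativeRing.setoid R) Q →
    ¬ IsPermutationPolynomial Λ-F ×
    (∃[ k ] HasCardinality (ValueSet Λ-F) k ×
            + k ≡ + Q ℤ.- + (Q / N) ×
            + Q ℤ.- + (Q / N) ≡ wanShiueChenBound Q N) ×
    AttainsWanShiueChenBound R Q Λ-F
corollary5p6 p e _ p-prime 1≤e ()  (divides zero    ≡.refl)
-- The inclusion 𝔽_N ⊆ 𝔽_Q is used as m = (k + 1) e, which gives Q = N^(k+1); m ≥ 1 has excluded the
-- quotient 0.
corollary5p6 p e m p-prime 1≤e 1≤m (divides (suc k) ≡.refl) F =
  Λ-values F p-prime e k (p ^ e) (p ^ m) {{primePower-nonZero p-prime e}} ≡.refl ≡.refl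
    (≡.trans (≡.cong (p ^_) (ℕ.*-comm (suc k) e)) (≡.sym (ℕ.^-*-assoc p e (suc k))))
    (ℕ.^-monoʳ-< p (ℕ.nonTrivial⇒n>1 p {{prime⇒nonTrivial p-prime}}) 1≤e)
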